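{- There is an absolute constant $C>0$ such that the following holds. Let $p$ be a prime, let $g$ be a primitive root modulo $p$, and let $N, K, M, H$ be any integers with $1\le N<p$ and $1\le K<p$. Let $J$ denote the number of integers $x\in[H+1,H+K]$ such that $g^x$ is congruent modulo $p$ to some integer in $[M+1,M+N]$. Then $$\left|J-\frac{KN}{p}\right|\le C\left(\frac{K^{1/2}N^{1/2}}{p^{1/4}}+p^{1/2}\right).$$
   Context: For a negative integer $x$, $g^x$ is understood modulo $p$, i.e. as a power of the inverse of $g$ modulo $p$. -}

module Defs where

open import Data.Nat.Base as ℕ using (ℕ; zero; suc)
open import Data.Nat.Primality using (Prime; prime⇒nonZero)
open import Data.Product.Base using (Σ; ∃; _×_; _,_; proj₁; proj₂; map₂)
open import Data.Sum.Base as ⊎ using (_⊎_; inj₁; inj₂)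
open import Data.Empty using (⊥)
open import Relation.Nullary.Negation using (contradiction)
open import Relation.Nullary.Decidable using (Dec; yes; no; map′)
open import Relation.Binary.Definitions using (tri<; tri≈; tri>)
open import Relation.Binary.PropositionalEquality
  using (_≡_; refl; sym; trans; cong; cong₂; subst; subst₂; module ≡-Reasoning)

-- Real numbers as two-sided (located) Dedekind cuts of ℚ.

module Reals where

  open import Data.Integer.Base as ℤ using (ℤ)
  import Data.Integer.Properties as ℤ
  open import Data.Nat.Coprimality using (1-coprimeTo) renaming (sym to coprime-sym)
  open import Data.Rational.Base hiding (Positive)
  open import Data.Rational.Properties
  open import Data.Rational.Solver

  open +-*-Solver using (solve; _:+_; _:*_; _:-_; :-_; _:=_; con)

  record ℝ : Set₁ where
    field
      -- Lower q means q < x, and Upper q means x < q.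
      Lower Upper     : ℚ → Set
      lower-inhabited : ∃ Lower
      upper-inhabited : ∃ Upper
      lower-closed    : ∀ {p q} → p < q → Lower q → Lower p
      upper-closed    : ∀ {p q} → p < q → Upper p → Upper q
      lower-open      : ∀ {q} → Lower q → ∃ λ r → q < r × Lower r
      upper-open      : ∀ {q} → Upper q → ∃ λ r → r < q × Upper r
      disjoint        : ∀ {q} → Lower q → Upper q → ⊥
      located         : ∀ {q r} → q < r → Lower q ⊎ Upper r

  open ℝ

  infix 4 _≤ᵣ_ _<ᵣ_

  _≤ᵣ_ : ℝ → ℝ → Set
  x ≤ᵣ y = ∀ q → Lower x q → Lower y q

  _<ᵣ_ : ℝ → ℝ → Set
  x <ᵣ y = ∃ λ q → Upper x q × Lower y q

  fromℚ : ℚ → ℝ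
  fromℚ p = record
    { Lower           = _< p
    ; Upper           = p <_
    ; lower-inhabited = p - 1ℚ , subst (p - 1ℚ <_) (+-identityʳ p) (+-monoʳ-< p (negative⁻¹ (- 1ℚ)))
    ; upper-inhabited = p + 1ℚ , subst (_< p + 1ℚ) (+-identityʳ p) (+-monoʳ-< p (positive⁻¹ 1ℚ))
    ; lower-closed    = <-trans
    ; upper-closed    = λ p<q r<p → <-trans r<p p<q
    ; lower-open      = <-dense
    ; upper-open      = λ p<q → let r , p<r , r<q = <-dense p<q in r , r<q , p<r
    ; disjoint        = <-asym
    ; located         = loc
    }
    where
    loc : ∀ {q r} → q < r → q < p ⊎ p < r
    loc {q} q<r with q <? p
    ... | yes q<p = inj₁ q<p
    ... | no  q≮p = inj₂ (≤-<-trans (≮⇒≥ q≮p) q<r)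

  fromℤ : ℤ → ℝ
  fromℤ i = fromℚ (i / 1)

  fromℕ : ℕ → ℝ
  fromℕ n = fromℤ (ℤ.+ n)

  0ᵣ : ℝ
  0ᵣ = fromℚ 0ℚ

  module _ (x : ℝ) where

    lower<upper : ∀ {a b} → Lower x a → Upper x b → a < b
    lower<upper {a} {b} la ub with <-cmp a b
    ... | tri< a<b _ _    = a<b
    ... | tri≈ _ refl _   = contradiction ub (disjoint x la)
    ... | tri> _ _ b<a    = contradiction (upper-closed x b<a ub) (disjoint x la)

    lower-⊔ : ∀ {a b} → Lower x a → Lower x b → Lower x (a ⊔ b)
    lower-⊔ {a} {b} la lb with ⊔-sel a b
    ... | inj₁ eq = subst (Lower x) (sym eq) la
    ... | inj₂ eq = subst (Lower x) (sym eq) lb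

    upper-⊓ : ∀ {a b} → Upper x a → Upper x b → Upper x (a ⊓ b)
    upper-⊓ {a} {b} ua ub with ⊓-sel a b
    ... | inj₁ eq = subst (Upper x) (sym eq) ua
    ... | inj₂ eq = subst (Upper x) (sym eq) ub

  private

    p<q⇒0<q-p : ∀ {p q} → p < q → 0ℚ < q - p
    p<q⇒0<q-p {p} {q} p<q = subst (_< q - p) (+-inverseʳ p) (+-monoˡ-< (- p) p<q)

    p<p+ε : ∀ p {ε} → 0ℚ < ε → p < p + ε
    p<p+ε p {ε} 0<ε = subst (_< p + ε) (+-identityʳ p) (+-monoʳ-< p 0<ε)

    pos*pos : ∀ {p q} → 0ℚ < p → 0ℚ < q → 0ℚ < p * q
    pos*pos {p} {q} 0<p 0<q =
      let instance _ = positive 0<p ; _ = positive 0<q ; _ = pos*pos⇒pos p q in positive⁻¹ (p * q)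

    pos*<pos* : ∀ {p q} r → 0ℚ < r → p < q → r * p < r * q
    pos*<pos* r 0<r p<q = *-monoʳ-<-pos r {{positive 0<r}} p<q

    *pos<*pos : ∀ {p q} r → 0ℚ < r → p < q → p * r < q * r
    *pos<*pos r 0<r p<q = *-monoˡ-<-pos r {{positive 0<r}} p<q

    recip : ∀ p → 0ℚ < p → ∃ λ r → 0ℚ < r × p * r ≡ 1ℚ
    recip p 0<p = 1/ p , positive⁻¹ _ {{1/pos⇒pos p}} , *-inverseʳ p
      where instance
        _ = positive 0<p
        _ = pos⇒nonZero p

    split : ∀ p q → q + (p - q) ≡ p
    split = solve 2 (λ p q → q :+ (p :- q) := p) refl

    infixr 8 _×ℚ_
    _×ℚ_ : ℕ → ℚ → ℚ
    zero  ×ℚ p = 0ℚ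
    suc n ×ℚ p = p + n ×ℚ p

    ×ℚ-* : ∀ n p → n ×ℚ p ≡ (n ×ℚ 1ℚ) * p
    ×ℚ-* zero    p = sym (*-zeroˡ p)
    ×ℚ-* (suc n) p = trans (cong₂ _+_ (sym (*-identityˡ p)) (×ℚ-* n p)) (sym (*-distribʳ-+ p 1ℚ (n ×ℚ 1ℚ)))

    ×ℚ1 : ∀ n → n ×ℚ 1ℚ ≡ mkℚ (ℤ.+ n) 0 (coprime-sym (1-coprimeTo n))
    ×ℚ1 zero    = refl
    ×ℚ1 (suc n) = trans (cong (1ℚ +_) (×ℚ1 n))
                  (trans (cong (_/ 1) (cong (ℤ._+_ (ℤ.+ 1)) (ℤ.*-identityʳ (ℤ.+ n))))
                         (normalize-coprime {suc n} {0} (coprime-sym (1-coprimeTo (suc n)))))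

    bounded : ∀ p → ∃ λ n → p ≤ n ×ℚ 1ℚ
    bounded (mkℚ i d c) = ℤ.∣ i ∣ , subst (mkℚ i d c ≤_) (sym (×ℚ1 ℤ.∣ i ∣)) (*≤* (begin
      i ℤ.* ℤ.+ 1               ≡⟨ ℤ.*-identityʳ i ⟩
      i                         ≤⟨ i≤∣i∣ i ⟩
      ℤ.+ ℤ.∣ i ∣               ≡⟨ ℤ.*-identityʳ (ℤ.+ ℤ.∣ i ∣) ⟨
      ℤ.+ ℤ.∣ i ∣ ℤ.* ℤ.+ 1     ≤⟨ ℤ.*-monoˡ-≤-nonNeg (ℤ.+ ℤ.∣ i ∣) (ℤ.+≤+ (ℕ.s≤s ℕ.z≤n)) ⟩
      ℤ.+ ℤ.∣ i ∣ ℤ.* ℤ.+ suc d ∎))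
      where
      open ℤ.≤-Reasoning
      i≤∣i∣ : ∀ i → i ℤ.≤ ℤ.+ ℤ.∣ i ∣
      i≤∣i∣ (ℤ.+ n)     = ℤ.≤-refl
      i≤∣i∣ (ℤ.-[1+ n ]) = ℤ.-≤+

    archimedean : ∀ p ε → 0ℚ < ε → ∃ λ n → p ≤ n ×ℚ ε
    archimedean p ε 0<ε =
      let r , 0<r , εr≡1 = recip ε 0<ε
          n , pr≤n       = bounded (p * r)
          p≡             = trans (solve 3 (λ p r ε → p :* r :* ε := p :* (ε :* r)) refl p r ε)
                                 (trans (cong (p *_) εr≡1) (*-identityʳ p))
      in n , subst₂ _≤_ p≡ (sym (×ℚ-* n ε))
               (*-monoʳ-≤-nonNeg ε {{pos⇒nonNeg ε {{positive 0<ε}}}} pr≤n)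

  approximate : ∀ x {ε} → 0ℚ < ε → ∃ λ a → Lower x a × Upper x (a + ε)
  approximate x {ε} 0<ε = search n a la (upper≤ b≤a+nδ ub)
    where
    δ = ½ * ε
    0<δ : 0ℚ < δ
    0<δ = pos*pos (positive⁻¹ ½) 0<ε
    δ+δ≡ε : ∀ a → (a + δ) + δ ≡ a + ε
    δ+δ≡ε a = solve 2 (λ a e → (a :+ con ½ :* e) :+ con ½ :* e := a :+ e) refl a ε
    a = proj₁ (lower-inhabited x)
    la = proj₂ (lower-inhabited x)
    b = proj₁ (upper-inhabited x)
    ub = proj₂ (upper-inhabited x)
    n = proj₁ (archimedean (b - a) δ 0<δ)
    b≤a+nδ : b ≤ a + n ×ℚ δ
    b≤a+nδ = subst (_≤ a + n ×ℚ δ) (split b a) (+-monoʳ-≤ a (proj₂ (archimedean (b - a) δ 0<δ)))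
    upper≤ : ∀ {p q} → p ≤ q → Upper x p → Upper x q
    upper≤ {p} {q} p≤q up with <-cmp p q
    ... | tri< p<q _ _  = upper-closed x p<q up
    ... | tri≈ _ refl _ = up
    ... | tri> _ _ q<p  = contradiction (<-≤-trans q<p p≤q) (<-irrefl refl)
    search : ∀ n a → Lower x a → Upper x (a + n ×ℚ δ) → ∃ λ a → Lower x a × Upper x (a + ε)
    search zero    a la u = contradiction (subst (Upper x) (+-identityʳ a) u) (disjoint x la)
    search (suc n) a la u with located x (p<p+ε (a + δ) 0<δ)
    ... | inj₁ l = search n (a + δ) l (subst (Upper x) (sym (+-assoc a δ (n ×ℚ δ))) u)
    ... | inj₂ v = a , la , subst (Upper x) (δ+δ≡ε a) v

  infixl 6 _+ᵣ_ _-ᵣ_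
  infixl 7 _*ᵣ_ _/ᵣ_
  infix  8 -ᵣ_

  _+ᵣ_ : ℝ → ℝ → ℝ
  x +ᵣ y = record
    { Lower           = L
    ; Upper           = U
    ; lower-inhabited =
        let a , la = lower-inhabited x ; b , lb = lower-inhabited y
            q , q< = lower-inhabited (fromℚ (a + b))
        in q , a , b , la , lb , q<
    ; upper-inhabited =
        let a , ua = upper-inhabited x ; b , ub = upper-inhabited y
            q , <q = upper-inhabited (fromℚ (a + b))
        in q , a , b , ua , ub , <q
    ; lower-closed    = λ { p<q (a , b , la , lb , q<) → a , b , la , lb , <-trans p<q q< }
    ; upper-closed    = λ { p<q (a , b , ua , ub , <p) → a , b , ua , ub , <-trans <p p<q }
    ; lower-open      = λ { (a , b , la , lb , q<) →
        let r , q<r , r< = <-dense q< in r , q<r , a , b , la , lb , r< }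
    ; upper-open      = λ { (a , b , ua , ub , <q) →
        let r , <r , r<q = <-dense <q in r , r<q , a , b , ua , ub , <r }
    ; disjoint        = λ { (a , b , la , lb , q<) (a′ , b′ , ua , ub , <q) →
        <-asym (<-trans q< (+-mono-< (lower<upper x la ua) (lower<upper y lb ub))) <q }
    ; located         = loc
    }
    where
    L U : ℚ → Set
    L q = ∃ λ a → ∃ λ b → Lower x a × Lower y b × q < a + b
    U q = ∃ λ a → ∃ λ b → Upper x a × Upper y b × a + b < q
    halves : ∀ a b s q → (a + b) + (s - q) ≡ (a + ½ * (s - q)) + (b + ½ * (s - q))
    halves = solve 4 (λ a b s q → (a :+ b) :+ (s :- q) :=
                                  (a :+ con ½ :* (s :- q)) :+ (b :+ con ½ :* (s :- q))) refl
    dec : ∀ {q r s a b} → s < r →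
          Lower x a → Upper x (a + ½ * (s - q)) → Lower y b → Upper y (b + ½ * (s - q)) →
          Dec (q < a + b) → L q ⊎ U r
    dec                     s<r la ua lb ub (yes q<) = inj₁ (_ , _ , la , lb , q<)
    dec {q} {s = s} {a} {b} s<r la ua lb ub (no q≮)  = inj₂ (_ , _ , ua , ub , ≤-<-trans bound s<r)
      where
      bound : (a + ½ * (s - q)) + (b + ½ * (s - q)) ≤ s
      bound = subst₂ _≤_ (halves a b s q) (split s q) (+-monoˡ-≤ (s - q) (≮⇒≥ q≮))
    loc : ∀ {q r} → q < r → L q ⊎ U r
    loc {q} q<r =
      let s , q<s , s<r = <-dense q<r
          0<ε           = pos*pos (positive⁻¹ ½) (p<q⇒0<q-p q<s)
          a , la , ua   = approximate x 0<ε
          b , lb , ub   = approximate y 0<ε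
      in dec s<r la ua lb ub (q <? a + b)

  -ᵣ_ : ℝ → ℝ
  -ᵣ x = record
    { Lower           = λ q → Upper x (- q)
    ; Upper           = λ q → Lower x (- q)
    ; lower-inhabited = let b , ub = upper-inhabited x in - b , subst (Upper x) (sym (neg² b)) ub
    ; upper-inhabited = let a , la = lower-inhabited x in - a , subst (Lower x) (sym (neg² a)) la
    ; lower-closed    = λ p<q → upper-closed x (neg-antimono-< p<q)
    ; upper-closed    = λ p<q → lower-closed x (neg-antimono-< p<q)
    ; lower-open      = λ {q} u → let r , r<-q , ur = upper-open x u in
        - r , subst (_< - r) (neg² q) (neg-antimono-< r<-q) , subst (Upper x) (sym (neg² r)) ur
    ; upper-open      = λ {q} l → let r , -q<r , lr = lower-open x l in
        - r , subst (- r <_) (neg² q) (neg-antimono-< -q<r) , subst (Lower x) (sym (neg² r)) lr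
    ; disjoint        = λ u l → disjoint x l u
    ; located         = λ q<r → ⊎.swap (located x (neg-antimono-< q<r))
    }
    where
    neg² : ∀ p → - - p ≡ p
    neg² = solve 1 (λ p → :- (:- p) := p) refl

  _-ᵣ_ : ℝ → ℝ → ℝ
  x -ᵣ y = x +ᵣ (-ᵣ y)

  infixl 6 _⊔ᵣ_

  _⊔ᵣ_ : ℝ → ℝ → ℝ
  x ⊔ᵣ y = record
    { Lower           = L
    ; Upper           = U
    ; lower-inhabited = map₂ inj₁ (lower-inhabited x)
    ; upper-inhabited =
        let a , ua = upper-inhabited x ; b , ub = upper-inhabited y
            q , <q = upper-inhabited (fromℚ (a ⊔ b))
        in q , upper-closed x (≤-<-trans (p≤p⊔q a b) <q) ua
             , upper-closed y (≤-<-trans (p≤q⊔p a b) <q) ub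
    ; lower-closed    = λ p<q → ⊎.map (lower-closed x p<q) (lower-closed y p<q)
    ; upper-closed    = λ { p<q (u , v) → upper-closed x p<q u , upper-closed y p<q v }
    ; lower-open      = λ
        { (inj₁ l) → let r , q<r , lr = lower-open x l in r , q<r , inj₁ lr
        ; (inj₂ l) → let r , q<r , lr = lower-open y l in r , q<r , inj₂ lr }
    ; upper-open      = uopen
    ; disjoint        = λ { (inj₁ l) (u , _) → disjoint x l u ; (inj₂ l) (_ , v) → disjoint y l v }
    ; located         = loc
    }
    where
    L U : ℚ → Set
    L q = Lower x q ⊎ Lower y q
    U q = Upper x q × Upper y q
    uopen : ∀ {q} → U q → ∃ λ r → r < q × U r
    uopen {q} (u , v) with upper-open x u | upper-open y v
    ... | a , a<q , ua | b , b<q , ub =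
      let m<q         = ⊔-< a<q b<q
          r , m<r , r<q = <-dense m<q
      in r , r<q , upper-closed x (≤-<-trans (p≤p⊔q a b) m<r) ua
                 , upper-closed y (≤-<-trans (p≤q⊔p a b) m<r) ub
      where
      ⊔-< : ∀ {a b} → a < q → b < q → a ⊔ b < q
      ⊔-< {a} {b} a<q b<q with ⊔-sel a b
      ... | inj₁ eq = subst (_< q) (sym eq) a<q
      ... | inj₂ eq = subst (_< q) (sym eq) b<q
    loc : ∀ {q r} → q < r → L q ⊎ U r
    loc q<r with located x q<r | located y q<r
    ... | inj₁ l | _      = inj₁ (inj₁ l)
    ... | inj₂ _ | inj₁ l = inj₁ (inj₂ l)
    ... | inj₂ u | inj₂ v = inj₂ (u , v)

  ∣_∣ᵣ : ℝ → ℝ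
  ∣ x ∣ᵣ = x ⊔ᵣ (-ᵣ x)

  -- Multiplication is interval multiplication: for x ∈ (a, b) and y ∈ (c, d)
  -- the product lies between the extreme corner products.
  record Box (x y : ℝ) : Set where
    constructor box
    field
      {a b c d} : ℚ
      a<x : Lower x a
      x<b : Upper x b
      c<y : Lower y c
      y<d : Upper y d

    lo hi : ℚ
    lo = ((a * c) ⊓ (a * d)) ⊓ ((b * c) ⊓ (b * d))
    hi = ((a * c) ⊔ (a * d)) ⊔ ((b * c) ⊔ (b * d))

  open Box using (lo; hi)

  private

    module _ {x y : ℝ} where

      box-bounds : (B : Box x y) (let open Box B using (a; b; c; d)) → ∀ {s t} →
                   a ≤ s → s ≤ b → c ≤ t → t ≤ d → lo B ≤ s * t × s * t ≤ hi B
      box-bounds B {s} {t} a≤s s≤b c≤t t≤d =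
        ≤-trans (⊓-mono-≤ {(a * c) ⊓ (a * d)} {a * t} (proj₁ (edgeˡ a)) (proj₁ (edgeˡ b))) (proj₁ edgeʳ) ,
        ≤-trans (proj₂ edgeʳ) (⊔-mono-≤ {(a * c) ⊔ (a * d)} {a * t} (proj₂ (edgeˡ a)) (proj₂ (edgeˡ b)))
        where
        open Box B using (a; b; c; d)
        edge : ∀ {a s b} t → a ≤ s → s ≤ b → ((a * t) ⊓ (b * t) ≤ s * t) × (s * t ≤ (a * t) ⊔ (b * t))
        edge {a} {s} {b} t a≤s s≤b with ≤-total 0ℚ t
        ... | inj₁ 0≤t = let instance _ = nonNegative 0≤t in
          ≤-trans (p⊓q≤p (a * t) (b * t)) (*-monoʳ-≤-nonNeg t a≤s) ,
          ≤-trans (*-monoʳ-≤-nonNeg t s≤b) (p≤q⊔p (a * t) (b * t))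
        ... | inj₂ t≤0 = let instance _ = nonPositive t≤0 in
          ≤-trans (p⊓q≤q (a * t) (b * t)) (*-monoʳ-≤-nonPos t s≤b) ,
          ≤-trans (*-monoʳ-≤-nonPos t a≤s) (p≤p⊔q (a * t) (b * t))
        edgeʳ : ((a * t) ⊓ (b * t) ≤ s * t) × (s * t ≤ (a * t) ⊔ (b * t))
        edgeʳ = edge t a≤s s≤b
        edgeˡ : ∀ u → ((u * c) ⊓ (u * d) ≤ u * t) × (u * t ≤ (u * c) ⊔ (u * d))
        edgeˡ u rewrite *-comm u c | *-comm u d | *-comm u t = edge u c≤t t≤d

      box-lo<hi : (B B′ : Box x y) → lo B ≤ hi B′
      box-lo<hi B B′ = ≤-trans
        (proj₁ (box-bounds B  (p≤p⊔q (a B) (a B′)) (<⇒≤ (lower<upper x la (x<b B)))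
                              (p≤p⊔q (c B) (c B′)) (<⇒≤ (lower<upper y lc (y<d B)))))
        (proj₂ (box-bounds B′ (p≤q⊔p (a B) (a B′)) (<⇒≤ (lower<upper x la (x<b B′)))
                              (p≤q⊔p (c B) (c B′)) (<⇒≤ (lower<upper y lc (y<d B′)))))
        where
        open Box
        la = lower-⊔ x (a<x B) (a<x B′)
        lc = lower-⊔ y (c<y B) (c<y B′)

    scale : ∀ {w ε v m} → 0ℚ ≤ w → w ≤ ε → 0ℚ ≤ m → - m ≤ v → v ≤ m →
            - (ε * m) ≤ w * v × w * v ≤ ε * m
    scale {w} {ε} {v} {m} 0≤w w≤ε 0≤m -m≤v v≤m =
      ≤-trans (neg-antimono-≤ wm≤εm) (subst (_≤ w * v) (sym (neg-distribʳ-* w m)) (*-monoˡ-≤-nonNeg w -m≤v)) ,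
      ≤-trans (*-monoˡ-≤-nonNeg w v≤m) wm≤εm
      where
      instance
        _ = nonNegative 0≤w
        _ = nonNegative 0≤m
      wm≤εm : w * m ≤ ε * m
      wm≤εm = *-monoʳ-≤-nonNeg m w≤ε

    corner : ∀ {a c u v ε m} → 0ℚ ≤ m → - m ≤ a → a ≤ m → - m ≤ v → v ≤ m →
             a ≤ u → u ≤ a + ε → c ≤ v → v ≤ c + ε →
             a * c - (ε * m + ε * m) ≤ u * v × u * v ≤ a * c + (ε * m + ε * m)
    corner {a} {c} {u} {v} {ε} {m} 0≤m -m≤a a≤m -m≤v v≤m a≤u u≤ c≤v v≤ =
      subst₂ _≤_ (cong (a * c +_) (sym (neg-distrib-+ (ε * m) (ε * m)))) expand
        (+-monoʳ-≤ (a * c) (+-mono-≤ (proj₁ s₁) (proj₁ s₂))) ,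
      subst (_≤ a * c + (ε * m + ε * m)) expand
        (+-monoʳ-≤ (a * c) (+-mono-≤ (proj₂ s₁) (proj₂ s₂)))
      where
      0≤- : ∀ {p q} → p ≤ q → 0ℚ ≤ q - p
      0≤- {p} {q} p≤q = subst (_≤ q - p) (+-inverseʳ p) (+-monoˡ-≤ (- p) p≤q)
      -≤ε : ∀ {p q} → q ≤ p + ε → q - p ≤ ε
      -≤ε {p} {q} q≤ = subst (q - p ≤_) (solve 2 (λ p e → (p :+ e) :- p := e) refl p ε) (+-monoˡ-≤ (- p) q≤)
      s₁ = scale (0≤- a≤u) (-≤ε u≤) 0≤m -m≤v v≤m
      s₂ = scale (0≤- c≤v) (-≤ε v≤) 0≤m -m≤a a≤m
      expand : a * c + ((u - a) * v + (v - c) * a) ≡ u * v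
      expand = solve 4 (λ a c u v → a :* c :+ ((u :- a) :* v :+ (v :- c) :* a) := u :* v) refl a c u v

    -- Boxes with arbitrarily close extreme corner products.
    thin-box : ∀ x y {η} → 0ℚ < η → Σ (Box x y) λ B → ∃ λ m → m - η ≤ lo B × hi B ≤ m + η
    thin-box x y {η} 0<η =
      box la ub lc ud , a * c ,
      ⊓-glb (⊓-glb (proj₁ k₁) (proj₁ k₂)) (⊓-glb (proj₁ k₃) (proj₁ k₄)) ,
      ⊔-lub (⊔-lub (proj₂ k₁) (proj₂ k₂)) (⊔-lub (proj₂ k₃) (proj₂ k₄))
      where
      a₀ = proj₁ (lower-inhabited x)
      b₀ = proj₁ (upper-inhabited x)
      c₀ = proj₁ (lower-inhabited y)
      d₀ = proj₁ (upper-inhabited y)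
      m₁ = - a₀ ⊔ b₀
      m₂ = - c₀ ⊔ d₀
      m = 1ℚ ⊔ (m₁ ⊔ m₂)
      0<m : 0ℚ < m
      0<m = <-≤-trans (positive⁻¹ 1ℚ) (p≤p⊔q 1ℚ (m₁ ⊔ m₂))
      m₁≤m : m₁ ≤ m
      m₁≤m = ≤-trans (p≤p⊔q m₁ m₂) (p≤q⊔p 1ℚ (m₁ ⊔ m₂))
      m₂≤m : m₂ ≤ m
      m₂≤m = ≤-trans (p≤q⊔p m₁ m₂) (p≤q⊔p 1ℚ (m₁ ⊔ m₂))
      neg≤ : ∀ {p q} → - p ≤ q → - q ≤ p
      neg≤ {p} {q} h = subst (- q ≤_) (solve 1 (λ p → :- (:- p) := p) refl p) (neg-antimono-≤ h)
      r = proj₁ (recip m 0<m)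
      ε = ½ * (η * r)
      0<ε : 0ℚ < ε
      0<ε = pos*pos (positive⁻¹ ½) (pos*pos 0<η (proj₁ (proj₂ (recip m 0<m))))
      εm+εm≡η : ε * m + ε * m ≡ η
      εm+εm≡η = trans
        (solve 3 (λ η r m → con ½ :* (η :* r) :* m :+ con ½ :* (η :* r) :* m := η :* (m :* r)) refl η r m)
        (trans (cong (η *_) (proj₂ (proj₂ (recip m 0<m)))) (*-identityʳ η))
      A = approximate x 0<ε
      C = approximate y 0<ε
      a = a₀ ⊔ proj₁ A
      b = b₀ ⊓ (proj₁ A + ε)
      c = c₀ ⊔ proj₁ C
      d = d₀ ⊓ (proj₁ C + ε)
      la = lower-⊔ x (proj₂ (lower-inhabited x)) (proj₁ (proj₂ A))
      ub = upper-⊓ x (proj₂ (upper-inhabited x)) (proj₂ (proj₂ A))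
      lc = lower-⊔ y (proj₂ (lower-inhabited y)) (proj₁ (proj₂ C))
      ud = upper-⊓ y (proj₂ (upper-inhabited y)) (proj₂ (proj₂ C))
      a≤b = <⇒≤ (lower<upper x la ub)
      c≤d = <⇒≤ (lower<upper y lc ud)
      b≤a+ε : b ≤ a + ε
      b≤a+ε = ≤-trans (p⊓q≤q b₀ _) (+-monoˡ-≤ ε (p≤q⊔p a₀ (proj₁ A)))
      d≤c+ε : d ≤ c + ε
      d≤c+ε = ≤-trans (p⊓q≤q d₀ _) (+-monoˡ-≤ ε (p≤q⊔p c₀ (proj₁ C)))
      -m≤a = ≤-trans (neg≤ {a₀} (≤-trans (p≤p⊔q (- a₀) b₀) m₁≤m)) (p≤p⊔q a₀ (proj₁ A))
      b≤m  = ≤-trans (p⊓q≤p b₀ (proj₁ A + ε)) (≤-trans (p≤q⊔p (- a₀) b₀) m₁≤m)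
      -m≤c = ≤-trans (neg≤ {c₀} (≤-trans (p≤p⊔q (- c₀) d₀) m₂≤m)) (p≤p⊔q c₀ (proj₁ C))
      d≤m  = ≤-trans (p⊓q≤p d₀ (proj₁ C + ε)) (≤-trans (p≤q⊔p (- c₀) d₀) m₂≤m)
      p≤p+ε : ∀ p → p ≤ p + ε
      p≤p+ε p = <⇒≤ (p<p+ε p 0<ε)
      k : ∀ {u v} → a ≤ u → u ≤ b → c ≤ v → v ≤ d → a * c - η ≤ u * v × u * v ≤ a * c + η
      k {u} {v} a≤u u≤b c≤v v≤d =
        subst (λ z → a * c - z ≤ u * v × u * v ≤ a * c + z) εm+εm≡η
          (corner (<⇒≤ 0<m) -m≤a (≤-trans a≤b b≤m) (≤-trans -m≤c c≤v) (≤-trans v≤d d≤m)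
                  a≤u (≤-trans u≤b b≤a+ε) c≤v (≤-trans v≤d d≤c+ε))
      k₁ = k ≤-refl a≤b ≤-refl c≤d
      k₂ = k ≤-refl a≤b c≤d ≤-refl
      k₃ = k a≤b ≤-refl ≤-refl c≤d
      k₄ = k a≤b ≤-refl c≤d ≤-refl

  _*ᵣ_ : ℝ → ℝ → ℝ
  x *ᵣ y = record
    { Lower           = L
    ; Upper           = U
    ; lower-inhabited = let q , q< = lower-inhabited (fromℚ (lo B₀)) in q , B₀ , q<
    ; upper-inhabited = let q , <q = upper-inhabited (fromℚ (hi B₀)) in q , B₀ , <q
    ; lower-closed    = λ { p<q (B , q<) → B , <-trans p<q q< }
    ; upper-closed    = λ { p<q (B , <p) → B , <-trans <p p<q }
    ; lower-open      = λ { (B , q<) → let r , q<r , r< = <-dense q< in r , q<r , B , r< }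
    ; upper-open      = λ { (B , <q) → let r , <r , r<q = <-dense <q in r , r<q , B , <r }
    ; disjoint        = λ { (B , q<) (B′ , <q) →
        <-irrefl refl (<-trans (<-≤-trans q< (box-lo<hi B B′)) <q) }
    ; located         = loc
    }
    where
    L U : ℚ → Set
    L q = Σ (Box x y) λ B → q < lo B
    U q = Σ (Box x y) λ B → hi B < q
    B₀ : Box x y
    B₀ = box (proj₂ (lower-inhabited x)) (proj₂ (upper-inhabited x))
             (proj₂ (lower-inhabited y)) (proj₂ (upper-inhabited y))
    halves : ∀ m s q → (m - ½ * (s - q)) + (s - q) ≡ m + ½ * (s - q)
    halves = solve 3 (λ m s q → (m :- con ½ :* (s :- q)) :+ (s :- q) := m :+ con ½ :* (s :- q)) refl
    dec : ∀ {q r s m} (B : Box x y) → s < r → m - ½ * (s - q) ≤ lo B → hi B ≤ m + ½ * (s - q) →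
          Dec (q < m - ½ * (s - q)) → L q ⊎ U r
    dec                 B s<r ≤lo hi≤ (yes q<) = inj₁ (B , <-≤-trans q< ≤lo)
    dec {q} {s = s} {m} B s<r ≤lo hi≤ (no q≮)  = inj₂ (B , ≤-<-trans (≤-trans hi≤ bound) s<r)
      where
      bound : m + ½ * (s - q) ≤ s
      bound = subst₂ _≤_ (halves m s q) (split s q) (+-monoˡ-≤ (s - q) (≮⇒≥ q≮))
    loc : ∀ {q r} → q < r → L q ⊎ U r
    loc {q} q<r =
      let s , q<s , s<r     = <-dense q<r
          B , m , ≤lo , hi≤ = thin-box x y (pos*pos (positive⁻¹ ½) (p<q⇒0<q-p q<s))
      in dec {m = m} B s<r ≤lo hi≤ (q <? m - ½ * (s - q))

  record Positive (x : ℝ) : Set where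
    constructor mkPositive
    field
      0<x : 0ᵣ <ᵣ x

    0-lower : Lower x 0ℚ
    0-lower = let q , 0<q , lq = 0<x in lower-closed x 0<q lq

  -- q < 1/x iff q < r for some r with b * r ≤ 1 for some b > x, and dually.
  1/ᵣ_ : (x : ℝ) → {{Positive x}} → ℝ
  1/ᵣ_ x {{x>0}} = record
    { Lower           = L
    ; Upper           = U
    ; lower-inhabited = let b , ub = upper-inhabited x in
        - 1ℚ , b , 0ℚ , ub , subst (_≤ 1ℚ) (sym (*-zeroʳ b)) (nonNegative⁻¹ 1ℚ) , negative⁻¹ (- 1ℚ)
    ; upper-inhabited =
        let a , 0<a , la     = lower-open x (Positive.0-lower x>0)
            r , 0<r , ar≡1   = recip a 0<a
        in r + 1ℚ , a , r , 0<a , la , ≤-reflexive (sym ar≡1) , p<p+ε r (positive⁻¹ 1ℚ)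
    ; lower-closed    = λ { p<q (b , r , ub , br≤1 , q<r) → b , r , ub , br≤1 , <-trans p<q q<r }
    ; upper-closed    = λ { p<q (a , r , 0<a , la , 1≤ar , r<p) → a , r , 0<a , la , 1≤ar , <-trans r<p p<q }
    ; lower-open      = λ { (b , r , ub , br≤1 , q<r) →
        let s , q<s , s<r = <-dense q<r in s , q<s , b , r , ub , br≤1 , s<r }
    ; upper-open      = λ { (a , r , 0<a , la , 1≤ar , r<q) →
        let s , r<s , s<q = <-dense r<q in s , s<q , a , r , 0<a , la , 1≤ar , r<s }
    ; disjoint        = disj
    ; located         = loc
    }
    where
    L U : ℚ → Set
    L q = ∃ λ b → ∃ λ r → Upper x b × b * r ≤ 1ℚ × q < r
    U q = ∃ λ a → ∃ λ r → 0ℚ < a × Lower x a × 1ℚ ≤ a * r × r < q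
    0<upper : ∀ {b} → Upper x b → 0ℚ < b
    0<upper = lower<upper x (Positive.0-lower x>0)
    disj : ∀ {q} → L q → U q → ⊥
    disj (b , r , ub , br≤1 , q<r) (a , r′ , 0<a , la , 1≤ar′ , r′<q) =
      <-irrefl refl (≤-<-trans 1≤ar′ (<-trans
        (*pos<*pos r′ 0<r′ (lower<upper x la ub))
        (<-≤-trans (pos*<pos* b (0<upper ub) (<-trans r′<q q<r)) br≤1)))
      where
      0<r′ : 0ℚ < r′
      0<r′ = *-cancelˡ-<-nonNeg a {{pos⇒nonNeg a {{positive 0<a}}}}
        (subst (_< a * r′) (sym (*-zeroʳ a)) (<-≤-trans (positive⁻¹ 1ℚ) 1≤ar′))
    dec : ∀ {q s t r} → q < s → s < t → t < r → Dec (0ℚ < s) → L q ⊎ U r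
    dec {s = s} q<s s<t t<r (no s≯0) = let b , ub = upper-inhabited x in
      inj₁ (b , s , ub , ≤-trans (subst (b * s ≤_) (*-zeroʳ b)
        (*-monoˡ-≤-nonNeg b {{pos⇒nonNeg b {{positive (0<upper ub)}}}} (≮⇒≥ s≯0))) (nonNegative⁻¹ 1ℚ) , q<s)
    dec {s = s} {t} q<s s<t t<r (yes 0<s) =
      let s⁻¹ , 0<s⁻¹ , ss⁻¹≡1 = recip s 0<s
          t⁻¹ , 0<t⁻¹ , tt⁻¹≡1 = recip t (<-trans 0<s s<t)
          t⁻¹<s⁻¹ = *-cancelˡ-<-nonNeg s {{pos⇒nonNeg s {{positive 0<s}}}}
            (<-≤-trans (*pos<*pos t⁻¹ 0<t⁻¹ s<t) (≤-reflexive (trans tt⁻¹≡1 (sym ss⁻¹≡1))))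
      in ⊎.swap (⊎.map
           (λ l → t⁻¹ , t , 0<t⁻¹ , l , ≤-reflexive (sym (trans (*-comm t⁻¹ t) tt⁻¹≡1)) , t<r)
           (λ u → s⁻¹ , s , u , ≤-reflexive (trans (*-comm s⁻¹ s) ss⁻¹≡1) , q<s)
           (located x t⁻¹<s⁻¹))
    loc : ∀ {q r} → q < r → L q ⊎ U r
    loc q<r =
      let t , q<t , t<r = <-dense q<r
          s , q<s , s<t = <-dense q<t
      in dec q<s s<t t<r (0ℚ <? s)

  _/ᵣ_ : ℝ → (y : ℝ) → {{Positive y}} → ℝ
  x /ᵣ y = x *ᵣ 1/ᵣ y

  -- q < √x iff q < 0 or q < r for some r ≥ 0 with r² < x; √x < q iff r < q for
  -- some r > 0 with x < r².  For x ≤ 0 this gives √x = 0.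
  infix 9 √_

  √_ : ℝ → ℝ
  √ x = record
    { Lower           = L
    ; Upper           = U
    ; lower-inhabited = - 1ℚ , inj₁ (negative⁻¹ (- 1ℚ))
    ; upper-inhabited = uinh
    ; lower-closed    = λ
        { p<q (inj₁ q<0)               → inj₁ (<-trans p<q q<0)
        ; p<q (inj₂ (r , q<r , 0≤r , l)) → inj₂ (r , <-trans p<q q<r , 0≤r , l) }
    ; upper-closed    = λ { p<q (r , r<p , 0<r , u) → r , <-trans r<p p<q , 0<r , u }
    ; lower-open      = λ
        { (inj₁ q<0)                 → let s , q<s , s<0 = <-dense q<0 in s , q<s , inj₁ s<0
        ; (inj₂ (r , q<r , 0≤r , l)) → let s , q<s , s<r = <-dense q<r in s , q<s , inj₂ (r , s<r , 0≤r , l) }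
    ; upper-open      = λ { (r , r<q , 0<r , u) →
        let s , r<s , s<q = <-dense r<q in s , s<q , r , r<s , 0<r , u }
    ; disjoint        = λ
        { (inj₁ q<0) (r , r<q , 0<r , u) → <-asym (<-trans 0<r r<q) q<0
        ; (inj₂ (s , q<s , 0≤s , l)) (r , r<q , 0<r , u) →
            <-asym (lower<upper x l u) (square-< 0<r (<-trans r<q q<s)) }
    ; located         = loc
    }
    where
    L U : ℚ → Set
    L q = q < 0ℚ ⊎ ∃ λ r → q < r × 0ℚ ≤ r × Lower x (r * r)
    U q = ∃ λ r → r < q × 0ℚ < r × Upper x (r * r)
    square-< : ∀ {p q} → 0ℚ < p → p < q → p * p < q * q
    square-< {p} {q} 0<p p<q = <-trans (pos*<pos* p 0<p p<q) (*pos<*pos q (<-trans 0<p p<q) p<q)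
    uinh : ∃ U
    uinh with upper-inhabited x
    ... | b , ub = r + 1ℚ , r , p<p+ε r (positive⁻¹ 1ℚ) , 0<r , upper-closed x b<r² ub
      where
      m = 1ℚ ⊔ b
      r = m + 1ℚ
      m<r : m < r
      m<r = p<p+ε m (positive⁻¹ 1ℚ)
      0<r : 0ℚ < r
      0<r = <-trans (<-≤-trans (positive⁻¹ 1ℚ) (p≤p⊔q 1ℚ b)) m<r
      b<r² : b < r * r
      b<r² = ≤-<-trans (p≤q⊔p 1ℚ b) (<-trans m<r
        (subst (_< r * r) (*-identityʳ r) (pos*<pos* r 0<r (≤-<-trans (p≤p⊔q 1ℚ b) m<r))))
    dec : ∀ {q s t r} → q < s → s < t → t < r → Dec (q < 0ℚ) → L q ⊎ U r
    dec         q<s s<t t<r (yes q<0) = inj₁ (inj₁ q<0)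
    dec {s = s} {t} q<s s<t t<r (no q≮0) = ⊎.map
      (λ l → inj₂ (s , q<s , <⇒≤ 0<s , l))
      (λ u → t , t<r , <-trans 0<s s<t , u)
      (located x (square-< 0<s s<t))
      where
      0<s : 0ℚ < s
      0<s = ≤-<-trans (≮⇒≥ q≮0) q<s
    loc : ∀ {q r} → q < r → L q ⊎ U r
    loc {q} q<r =
      let t , q<t , t<r = <-dense q<r
          s , q<s , s<t = <-dense q<t
      in dec q<s s<t t<r (q <? 0ℚ)

  instance
    fromℕ-positive : ∀ {n} .{{_ : ℕ.NonZero n}} → Positive (fromℕ n)
    fromℕ-positive {suc n} = mkPositive (<-dense (positive⁻¹ (ℤ.+ suc n / 1) {{normalize-pos (suc n) 1}}))

    √-positive : ∀ {x} {{_ : Positive x}} → Positive (√ x)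
    √-positive {x} {{x>0}} with Positive.0<x x>0
    ... | q , 0<q , lq = mkPositive (let r , 0<r , r<s = <-dense 0<s in r , 0<r , inj₂ (s , r<s , <⇒≤ 0<s , ls²))
      where
      s = 1ℚ ⊓ q
      0<s : 0ℚ < s
      0<s with ⊓-sel 1ℚ q
      ... | inj₁ eq = subst (0ℚ <_) (sym eq) (positive⁻¹ 1ℚ)
      ... | inj₂ eq = subst (0ℚ <_) (sym eq) 0<q
      s²≤q : s * s ≤ q
      s²≤q = ≤-trans (subst (s * s ≤_) (*-identityʳ s)
               (*-monoˡ-≤-nonNeg s {{pos⇒nonNeg s {{positive 0<s}}}} (p⊓q≤p 1ℚ q))) (p⊓q≤q 1ℚ q)
      ls² : Lower x (s * s)
      ls² = let r , q<r , lr = lower-open x lq in lower-closed x (≤-<-trans s²≤q q<r) lr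

open Reals public
  using (ℝ; _≤ᵣ_; _<ᵣ_; fromℚ; fromℤ; fromℕ; 0ᵣ; _+ᵣ_; -ᵣ_; _-ᵣ_; _*ᵣ_; _/ᵣ_; 1/ᵣ_; √_; ∣_∣ᵣ;
         Positive; fromℕ-positive; √-positive)

module Modular where

  open import Data.Integer.Base hiding (suc)
  open import Data.Integer.Properties
  open import Data.Integer.Divisibility.Signed using (_∣_; divides; _∣?_)
  open import Data.Integer.Coprimality using (Coprime)
  open import Data.Integer.Tactic.RingSolver using (solve-∀)
  open import Algebra.Properties.AbelianGroup +-0-abelianGroup using (∙-cancelˡ)
  open import Data.Nat.Coprimality using (coprime-Bézout)
  import Data.Nat.Properties as ℕ
  open import Data.Nat.GCD using (module Bézout)
  open import Data.List.Base using (List; map; upTo; filter; length)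
  open import Data.List.Membership.Propositional using (_∈_; find; lose)
  open import Data.List.Membership.Propositional.Properties using (∈-map⁺; ∈-map⁻; ∈-upTo⁺; ∈-upTo⁻)
  open import Data.List.Relation.Unary.Any using (any?)
  open import Data.List.Relation.Unary.Unique.Propositional using (Unique)
  open import Data.List.Relation.Unary.Unique.Propositional.Properties using (map⁺; upTo⁺)

  infix 4 _≡_[mod_]

  _≡_[mod_] : ℤ → ℤ → ℕ → Set
  a ≡ b [mod p ] = + p ∣ a - b

  record PrimitiveRoot (p : ℕ) (g : ℤ) : Set where
    field
      coprime   : Coprime g (+ p)
      generates : ∀ a → Coprime a (+ p) → ∃ λ k → g ^ k ≡ a [mod p ]

  private
    *-sign-∣∣ : ∀ g x → g * ((sign g ◃ 1) * + x) ≡ + (x ℕ.* ∣ g ∣)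
    *-sign-∣∣ (+ n) x = trans (cong (+ n *_) (*-identityˡ (+ x)))
      (trans (sym (pos-* n x)) (cong +_ (ℕ.*-comm n x)))
    *-sign-∣∣ -[1+ n ] x = trans (neg-neg (+ suc n) (+ x)) (sym (pos-* x (suc n)))
      where
      neg-neg : ∀ a b → (- a) * (-1ℤ * b) ≡ b * a
      neg-neg = solve-∀

  modularInverse : ∀ p g → Coprime g (+ p) → ∃ λ h → g * h ≡ 1ℤ [mod p ]
  modularInverse p g c with coprime-Bézout c
  ... | Bézout.+- x y 1+yp≡xg = sg * + x , divides (+ y) (begin
      g * (sg * + x) - 1ℤ        ≡⟨ cong (_- 1ℤ) (*-sign-∣∣ g x) ⟩
      + (x ℕ.* ∣ g ∣) - 1ℤ       ≡⟨ cong (λ z → + z - 1ℤ) 1+yp≡xg ⟨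
      1ℤ + + (y ℕ.* p) - 1ℤ      ≡⟨ cancel (+ (y ℕ.* p)) ⟩
      + (y ℕ.* p)                ≡⟨ pos-* y p ⟩
      + y * + p                  ∎)
    where
    open ≡-Reasoning
    sg = sign g ◃ 1
    cancel : ∀ z → 1ℤ + z - 1ℤ ≡ z
    cancel = solve-∀
  ... | Bézout.-+ x y 1+xg≡yp = - (sg * + x) , divides (- + y) (begin
      g * - (sg * + x) - 1ℤ      ≡⟨ neg-out g (sg * + x) ⟩
      - (1ℤ + g * (sg * + x))    ≡⟨ cong (λ z → - (1ℤ + z)) (*-sign-∣∣ g x) ⟩
      - + (1 ℕ.+ x ℕ.* ∣ g ∣)    ≡⟨ cong (λ z → - + z) 1+xg≡yp ⟩
      - + (y ℕ.* p)              ≡⟨ cong -_ (pos-* y p) ⟩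
      - (+ y * + p)              ≡⟨ neg-distribˡ-* (+ y) (+ p) ⟩
      - + y * + p                ∎)
    where
    open ≡-Reasoning
    sg = sign g ◃ 1
    neg-out : ∀ a b → a * - b - 1ℤ ≡ - (1ℤ + a * b)
    neg-out = solve-∀

  -- h stands for an inverse of g.
  power : (g h : ℤ) → ℤ → ℤ
  power g h (+ n)      = g ^ n
  power g h (-[1+ n ]) = h ^ suc n

  interval : ℤ → ℤ → List ℤ
  interval a b = map (λ i → a + + i) (upTo ∣ (1ℤ + b - a) ⊔ 0ℤ ∣)

  private
    length-interval : ∀ a b → + ∣ (1ℤ + b - a) ⊔ 0ℤ ∣ ≡ (1ℤ + b - a) ⊔ 0ℤ
    length-interval a b = 0≤i⇒+∣i∣≡i (i≤j⊔i (1ℤ + b - a) 0ℤ)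

  ∈-interval⁻ : ∀ {a b x} → x ∈ interval a b → a ≤ x × x ≤ b
  ∈-interval⁻ {a} {b} x∈ with ∈-map⁻ _ x∈
  ... | i , i∈ , refl = i≤i+j a (+ i) , i<n⇒a+i≤b
    where
    rearrange : ∀ a b → a + (1ℤ + b - a) ≡ 1ℤ + b
    rearrange = solve-∀
    i<⊔ : + i < (1ℤ + b - a) ⊔ 0ℤ
    i<⊔ = subst (+ i <_) (length-interval a b) (+<+ (∈-upTo⁻ i∈))
    i< : + i < 1ℤ + b - a
    i< with ⊔-sel (1ℤ + b - a) 0ℤ
    ... | inj₁ eq = subst (+ i <_) eq i<⊔
    ... | inj₂ eq = contradiction (subst (+ i <_) eq i<⊔) λ { (+<+ ()) }
    i<n⇒a+i≤b : a + + i ≤ b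
    i<n⇒a+i≤b = subst (a + + i ≤_) (pred-suc b)
      (i<j⇒i≤pred[j] (subst (a + + i <_) (rearrange a b) (+-monoʳ-< a i<)))

  ∈-interval⁺ : ∀ {a b x} → a ≤ x → x ≤ b → x ∈ interval a b
  ∈-interval⁺ {a} {b} {x} a≤x x≤b =
    subst (_∈ interval a b) (trans (cong (λ z → a + z) x-a) (add-sub a x))
      (∈-map⁺ (λ i → a + + i) (∈-upTo⁺ (drop‿+<+ (begin-strict
        + ∣ x - a ∣                      ≡⟨ x-a ⟩
        x - a                            <⟨ suc[i]≤j⇒i<j ≤-refl ⟩
        1ℤ + (x - a)                     ≤⟨ +-monoʳ-≤ 1ℤ (+-monoˡ-≤ (- a) x≤b) ⟩
        1ℤ + (b - a)                     ≡⟨ +-assoc 1ℤ b (- a) ⟨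
        1ℤ + b - a                       ≤⟨ i≤i⊔j (1ℤ + b - a) 0ℤ ⟩
        (1ℤ + b - a) ⊔ 0ℤ                ≡⟨ length-interval a b ⟨
        + ∣ (1ℤ + b - a) ⊔ 0ℤ ∣          ∎))))
    where
    open ≤-Reasoning
    x-a : + ∣ x - a ∣ ≡ x - a
    x-a = 0≤i⇒+∣i∣≡i (i≤j⇒0≤j-i a≤x)
    add-sub : ∀ a x → a + (x - a) ≡ x
    add-sub = solve-∀

  interval-unique : ∀ a b → Unique (interval a b)
  interval-unique a b = map⁺ (λ eq → +-injective (∙-cancelˡ a _ _ eq)) (upTo⁺ _)

  CongruentInto : ℕ → ℤ → (a b : ℤ) → Set
  CongruentInto p z a b = ∃ λ y → a ≤ y × y ≤ b × z ≡ y [mod p ]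

  congruentInto? : ∀ p z a b → Dec (CongruentInto p z a b)
  congruentInto? p z a b = map′
    (λ any → let y , y∈ , eq = find any ; a≤y , y≤b = ∈-interval⁻ y∈ in y , a≤y , y≤b , eq)
    (λ { (y , a≤y , y≤b , eq) → lose (∈-interval⁺ a≤y y≤b) eq })
    (any? (λ y → + p ∣? z - y) (interval a b))

  powersInInterval : (p : ℕ) (g : ℤ) → PrimitiveRoot p g → (H K M N : ℤ) → ℕ
  powersInInterval p g root H K M N =
    length (filter (λ x → congruentInto? p (power g g⁻¹ x) (M + 1ℤ) (M + N))
                   (interval (H + 1ℤ) (H + K)))
    where
    g⁻¹ = proj₁ (modularInverse p g (PrimitiveRoot.coprime root))

open Modular public
  using (_≡_[mod_]; PrimitiveRoot; modularInverse; power; interval; ∈-interval⁻; ∈-interval⁺;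
         interval-unique; CongruentInto; congruentInto?; powersInInterval)

-- For points (x , y) of the plane over 𝔽_p the number of points on the line y = u x − t has, over all
-- (u , t), variance at most 1/p times the number of coincident pairs. Take the points (g^x , y) with
-- (x , y) in a K′ × N′ box, each residue pair being hit at most four times. The line with u = g^s
-- counts the solutions of g^x ≡ y in the box translated by (s , t), and these lines are distinct for
-- s < k ≤ p − 1 and t < n ≤ p. Enlarging the K × N box by k and n, all k n translates contain the
-- original box; shrinking it, all are contained in it. Hence an excess or a deficit of p J over K′ N′
-- is repeated k n times in the variance, so that its square is at most 4 p³ K′ N′ / (k n). The choice
-- k ≈ K / t, n ≈ N / t with t² ≈ max (1 , K N / p^(3/2)) balances this with |K′ N′ − K N|.

module Submission where

open import Defs

-- Working with a second moment instead of a completed exponential sum is what avoids logarithms.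
-- Write w for p^(3/2). The variance bounds the excess of p J over the area by about w (K N / (k
-- n))^(1/2), which is w t for k = K / t and n = N / t. Resizing the box changes the area by about K
-- N / t, which is of order t w once K N ≤ 4 t² w. So p J and K N differ by O(t w), and t w / p
-- yields the two terms of the theorem: for t = 1 it is p^(1/2); otherwise t² w ≤ K N, so t w ≤ (K N
-- w)^(1/2) and t w / p ≤ (K N)^(1/2) / p^(1/4).
--
-- An enlarged side can be as long as two periods, so each coordinate may repeat once; hence the
-- four coincidences per point.
--
-- Real numbers are cuts, so the argument up to p J ≤ K N + 20 t w and its mirror image runs in ℕ,
-- with roots rounded to integers and fourth powers compared. Only then are rational lower cuts
-- produced for the right-hand side; each strict inequality there costs a small factor, which the
-- constant 3841 absorbs.

-- Finite sums over lists and Iverson brackets.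

module Sums where

  open import Data.Nat.Base
  open import Data.Nat.Properties
  open import Data.Nat.ListAction using (sum)
  open import Data.Nat.ListAction.Properties using (sum-++)
  open import Data.Nat.Tactic.RingSolver using (solve-∀)
  open import Data.List.Base using (List; []; _∷_; map; length; filter; cartesianProduct)
  open import Data.List.Properties using (map-++; map-∘; map-cong)
  open import Data.List.Membership.Propositional using (_∈_)
  open import Data.List.Relation.Unary.Any using (here; there)
  open import Data.List.Relation.Unary.All using (lookup)
  open import Data.List.Relation.Unary.AllPairs using ([]; _∷_)
  open import Data.List.Relation.Unary.Unique.Propositional using (Unique)
  open import Data.Product.Base using (_×_; _,_)
  open import Data.Empty using (⊥-elim)
  open import Function.Base using (_∘_)
  open import Relation.Nullary.Decidable using (Dec; yes; no; _×-dec_; ¬?)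
  open import Relation.Nullary.Negation using (¬_)
  open import Relation.Binary.Definitions using (DecidableEquality)
  open import Relation.Binary.PropositionalEquality
  open import Relation.Unary using (Decidable)

  private
    variable
      A B : Set
      P Q R : Set

  ⟦_⟧ : Dec P → ℕ
  ⟦ yes _ ⟧ = 1
  ⟦ no  _ ⟧ = 0

  ⟦⟧-mono : (P? : Dec P) (Q? : Dec Q) → (P → Q) → ⟦ P? ⟧ ≤ ⟦ Q? ⟧
  ⟦⟧-mono (no _)  Q?      f = z≤n
  ⟦⟧-mono (yes p) (yes _) f = ≤-refl
  ⟦⟧-mono (yes p) (no ¬q) f = ⊥-elim (¬q (f p))

  ⟦⟧-cong : (P? : Dec P) (Q? : Dec Q) → (P → Q) → (Q → P) → ⟦ P? ⟧ ≡ ⟦ Q? ⟧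
  ⟦⟧-cong P? Q? f g = ≤-antisym (⟦⟧-mono P? Q? f) (⟦⟧-mono Q? P? g)

  ⟦⟧-true : (P? : Dec P) → P → 1 ≤ ⟦ P? ⟧
  ⟦⟧-true (yes _) _ = ≤-refl
  ⟦⟧-true (no ¬p) p = ⊥-elim (¬p p)

  ⟦⟧-false : (P? : Dec P) → ¬ P → ⟦ P? ⟧ ≡ 0
  ⟦⟧-false (yes p) ¬p = ⊥-elim (¬p p)
  ⟦⟧-false (no _)  _  = refl

  ⟦⟧≤1 : (P? : Dec P) → ⟦ P? ⟧ ≤ 1
  ⟦⟧≤1 (yes _) = ≤-refl
  ⟦⟧≤1 (no _)  = z≤n

  -- Serves to replace "both points lie on the line with intercept t" by a condition free of t,
  -- while one bracket survives so that the sum over t can still be bounded by 1.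
  ⟦⟧-* : (P? : Dec P) (Q? : Dec Q) (R? : Dec R) → (P → Q → R) → ⟦ P? ⟧ * ⟦ Q? ⟧ ≤ ⟦ R? ⟧ * ⟦ P? ⟧
  ⟦⟧-* (no _)  Q?      R?      f = z≤n
  ⟦⟧-* (yes _) (no _)  R?      f = z≤n
  ⟦⟧-* (yes _) (yes _) (yes _) f = ≤-refl
  ⟦⟧-* (yes p) (yes q) (no ¬r) f = ⊥-elim (¬r (f p q))

  ⟦×⟧ : (P? : Dec P) (Q? : Dec Q) → ⟦ P? ×-dec Q? ⟧ ≡ ⟦ P? ⟧ * ⟦ Q? ⟧
  ⟦×⟧ (no _)  Q?      = refl
  ⟦×⟧ (yes _) (yes _) = refl
  ⟦×⟧ (yes _) (no _)  = refl

  ∑ : List A → (A → ℕ) → ℕ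
  ∑ xs f = sum (map f xs)

  infix 5 ∑
  syntax ∑ xs (λ x → e) = ∑[ x ∈ xs ] e

  ∑-cong : (xs : List A) {f g : A → ℕ} → (∀ x → f x ≡ g x) → ∑ xs f ≡ ∑ xs g
  ∑-cong xs f≡g = cong sum (map-cong f≡g xs)

  ∑-mono : (xs : List A) {f g : A → ℕ} → (∀ {x} → x ∈ xs → f x ≤ g x) → ∑ xs f ≤ ∑ xs g
  ∑-mono []       f≤g = z≤n
  ∑-mono (x ∷ xs) f≤g = +-mono-≤ (f≤g (here refl)) (∑-mono xs (f≤g ∘ there))

  ∑-const : (xs : List A) (c : ℕ) → ∑[ x ∈ xs ] c ≡ length xs * c
  ∑-const []       c = refl
  ∑-const (x ∷ xs) c = cong (c +_) (∑-const xs c)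

  ∑-+ : (xs : List A) (f g : A → ℕ) → ∑[ x ∈ xs ] (f x + g x) ≡ ∑ xs f + ∑ xs g
  ∑-+ []       f g = refl
  ∑-+ (x ∷ xs) f g = trans (cong (f x + g x +_) (∑-+ xs f g)) (interchange (f x) (g x) (∑ xs f) (∑ xs g))
    where
    interchange : ∀ a b c d → a + b + (c + d) ≡ a + c + (b + d)
    interchange = solve-∀

  ∑-*ˡ : (c : ℕ) (xs : List A) (f : A → ℕ) → ∑[ x ∈ xs ] (c * f x) ≡ c * ∑ xs f
  ∑-*ˡ c []       f = sym (*-zeroʳ c)
  ∑-*ˡ c (x ∷ xs) f = trans (cong (c * f x +_) (∑-*ˡ c xs f)) (sym (*-distribˡ-+ c (f x) (∑ xs f)))

  ∑-*ʳ : (xs : List A) (f : A → ℕ) (c : ℕ) → ∑[ x ∈ xs ] (f x * c) ≡ ∑ xs f * c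
  ∑-*ʳ xs f c = trans (∑-cong xs (λ x → *-comm (f x) c)) (trans (∑-*ˡ c xs f) (*-comm c (∑ xs f)))

  ∑-*-∑ : (xs : List A) (f : A → ℕ) (ys : List B) (g : B → ℕ) →
          ∑ xs f * ∑ ys g ≡ ∑[ x ∈ xs ] ∑[ y ∈ ys ] f x * g y
  ∑-*-∑ xs f ys g = trans (sym (∑-*ʳ xs f (∑ ys g))) (∑-cong xs (λ x → sym (∑-*ˡ (f x) ys g)))

  ∑-swap : (xs : List A) (ys : List B) (f : A → B → ℕ) →
           ∑[ x ∈ xs ] ∑[ y ∈ ys ] f x y ≡ ∑[ y ∈ ys ] ∑[ x ∈ xs ] f x y
  ∑-swap []       ys f = sym (trans (∑-const ys 0) (*-zeroʳ (length ys)))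
  ∑-swap (x ∷ xs) ys f = trans (cong (∑ ys (f x) +_) (∑-swap xs ys f))
                               (sym (∑-+ ys (f x) (λ y → ∑[ x′ ∈ xs ] f x′ y)))

  ∑-map : (h : A → B) (xs : List A) (f : B → ℕ) → ∑ (map h xs) f ≡ ∑ xs (f ∘ h)
  ∑-map h xs f = cong sum (sym (map-∘ xs))

  ∑-cartesianProduct : (xs : List A) (ys : List B) (f : A × B → ℕ) →
                       ∑ (cartesianProduct xs ys) f ≡ ∑[ x ∈ xs ] ∑[ y ∈ ys ] f (x , y)
  ∑-cartesianProduct []       ys f = refl
  ∑-cartesianProduct (x ∷ xs) ys f = trans
    (cong sum (map-++ f (map (x ,_) ys) (cartesianProduct xs ys)))
    (trans (sum-++ (map f (map (x ,_) ys)) (map f (cartesianProduct xs ys)))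
           (cong₂ _+_ (∑-map (x ,_) ys f) (∑-cartesianProduct xs ys f)))

  ∑-term : {xs : List A} (f : A → ℕ) {x : A} → x ∈ xs → f x ≤ ∑ xs f
  ∑-term f (here refl) = m≤m+n _ _
  ∑-term f (there x∈)  = ≤-trans (∑-term f x∈) (m≤n+m _ _)

  length-filter : {P : A → Set} (P? : Decidable P) (xs : List A) → length (filter P? xs) ≡ ∑ xs (⟦_⟧ ∘ P?)
  length-filter P? []       = refl
  length-filter P? (x ∷ xs) with P? x
  ... | yes _ = cong suc (length-filter P? xs)
  ... | no  _ = length-filter P? xs

  ∑-at-most-one : {P : A → Set} (P? : Decidable P) {xs : List A} → Unique xs →
                  (∀ {x y} → x ∈ xs → y ∈ xs → P x → P y → x ≡ y) → ∑ xs (⟦_⟧ ∘ P?) ≤ 1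
  ∑-at-most-one P? []                       inj = z≤n
  ∑-at-most-one P? {x ∷ xs} (x∉xs ∷ unique) inj with P? x
  ... | no _   = ∑-at-most-one P? unique (λ y∈ z∈ → inj (there y∈) (there z∈))
  ... | yes px = s≤s (≤-reflexive (n≤0⇒n≡0 (≤-trans (∑-mono xs none) (≤-reflexive zeros))))
    where
    none : ∀ {y} → y ∈ xs → ⟦ P? y ⟧ ≤ 0
    none {y} y∈ = ≤-reflexive (⟦⟧-false (P? y) λ py → lookup x∉xs y∈ (inj (here refl) (there y∈) px py))
    zeros : ∑[ y ∈ xs ] 0 ≡ 0
    zeros = trans (∑-const xs 0) (*-zeroʳ (length xs))

  -- Meant for a residue class met in a range of up to two periods: `Q` marks the first period, and
  -- the class occurs at most once on either side.
  ∑-at-most-two : {P Q : A → Set} (P? : Decidable P) (Q? : Decidable Q) {xs : List A} → Unique xs →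
                  (∀ {x y} → x ∈ xs → y ∈ xs → P x → P y → Q x → Q y → x ≡ y) →
                  (∀ {x y} → x ∈ xs → y ∈ xs → P x → P y → ¬ Q x → ¬ Q y → x ≡ y) →
                  ∑ xs (⟦_⟧ ∘ P?) ≤ 2
  ∑-at-most-two P? Q? {xs} unique inj inj′ = begin
    ∑ xs (⟦_⟧ ∘ P?)                                          ≤⟨ ∑-mono xs (λ {x} _ → split (P? x) (Q? x)) ⟩
    ∑[ x ∈ xs ] (⟦ P? x ×-dec Q? x ⟧ + ⟦ P? x ×-dec ¬? (Q? x) ⟧) ≡⟨ ∑-+ xs _ _ ⟩
    (∑[ x ∈ xs ] ⟦ P? x ×-dec Q? x ⟧) + (∑[ x ∈ xs ] ⟦ P? x ×-dec ¬? (Q? x) ⟧)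
      ≤⟨ +-mono-≤ (∑-at-most-one (λ x → P? x ×-dec Q? x) unique λ x∈ y∈ (px , qx) (py , qy) → inj x∈ y∈ px py qx qy)
                  (∑-at-most-one (λ x → P? x ×-dec ¬? (Q? x)) unique λ x∈ y∈ (px , qx) (py , qy) → inj′ x∈ y∈ px py qx qy) ⟩
    2 ∎
    where
    open ≤-Reasoning
    split : {P Q : Set} (P? : Dec P) (Q? : Dec Q) → ⟦ P? ⟧ ≤ ⟦ P? ×-dec Q? ⟧ + ⟦ P? ×-dec ¬? Q? ⟧
    split (no _)  Q?      = z≤n
    split (yes _) (yes _) = ≤-refl
    split (yes _) (no _)  = ≤-refl

  -- Double counting: each G (h x) is recovered inside a sum over `ys` weighted by ⟦ h x ≟ y ⟧, and
  -- after the swap the total weight at each y is at most 1 by injectivity.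
  ∑-injection : DecidableEquality B → {xs : List A} {ys : List B} (h : A → B) → Unique xs →
                (∀ {x} → x ∈ xs → h x ∈ ys) →
                (∀ {x y} → x ∈ xs → y ∈ xs → h x ≡ h y → x ≡ y) →
                (G : B → ℕ) → ∑ xs (G ∘ h) ≤ ∑ ys G
  ∑-injection _≟ᴮ_ {xs} {ys} h unique h∈ inj G = begin
    ∑[ x ∈ xs ] G (h x)                              ≤⟨ ∑-mono xs pick ⟩
    ∑[ x ∈ xs ] ∑[ y ∈ ys ] ⟦ h x ≟ᴮ y ⟧ * G y       ≡⟨ ∑-swap xs ys _ ⟩
    ∑[ y ∈ ys ] ∑[ x ∈ xs ] ⟦ h x ≟ᴮ y ⟧ * G y       ≡⟨ ∑-cong ys (λ y → ∑-*ʳ xs _ (G y)) ⟩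
    ∑[ y ∈ ys ] (∑[ x ∈ xs ] ⟦ h x ≟ᴮ y ⟧) * G y     ≤⟨ ∑-mono ys (λ {y} _ → *-monoˡ-≤ (G y) (once y)) ⟩
    ∑[ y ∈ ys ] 1 * G y                              ≡⟨ ∑-cong ys (λ y → *-identityˡ (G y)) ⟩
    ∑ ys G                                           ∎
    where
    open ≤-Reasoning
    pick : ∀ {x} → x ∈ xs → G (h x) ≤ ∑[ y ∈ ys ] ⟦ h x ≟ᴮ y ⟧ * G y
    pick {x} x∈ = ≤-trans
      (subst (_≤ ⟦ h x ≟ᴮ h x ⟧ * G (h x)) (*-identityˡ (G (h x))) (*-monoˡ-≤ (G (h x)) (⟦⟧-true (h x ≟ᴮ h x) refl)))
      (∑-term (λ y → ⟦ h x ≟ᴮ y ⟧ * G y) (h∈ x∈))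
    once : ∀ y → ∑[ x ∈ xs ] ⟦ h x ≟ᴮ y ⟧ ≤ 1
    once y = ∑-at-most-one (λ x → h x ≟ᴮ y) unique (λ x∈ x′∈ e e′ → inj x∈ x′∈ (trans e (sym e′)))

-- Congruences, and the moments of point-line incidences over 𝔽_p.

module Incidences where

  open Sums
  open import Data.Nat.Base as ℕ using (ℕ; suc; NonZero; ∣_-_∣)
  import Data.Nat.Properties as ℕ
  import Data.Nat.Divisibility as ℕ
  import Data.Nat.Tactic.RingSolver as ℕ-Solver
  open import Data.Nat.Primality using (Prime; prime⇒nonZero; euclidsLemma)
  open import Data.Integer.Base using (ℤ; +_; _⊖_; _+_; _*_; _-_; -_) renaming (∣_∣ to abs)
  open import Data.Integer.Properties using (abs-*; m-n≡m⊖n; ⊖-≥; ∣m⊖n∣≡∣n⊖m∣)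
  open import Data.Integer.DivMod using (_%ℕ_; _/ℕ_; n%ℕd<d; a≡a%ℕn+[a/ℕn]*n)
  open import Data.Integer.Divisibility.Signed
    using (_∣_; divides; _∣?_; ∣⇒∣ᵤ; ∣ᵤ⇒∣; ∣m∣n⇒∣m+n; ∣m∣n⇒∣m-n; ∣m⇒∣-m; ∣n⇒∣m*n; ∣m⇒∣m*n)
  open import Data.Integer.Tactic.RingSolver using (solve-∀)
  open import Data.List.Base using (List; upTo; length)
  open import Data.List.Properties using (length-upTo)
  open import Data.List.Membership.Propositional using (_∈_)
  open import Data.List.Membership.Propositional.Properties using (∈-upTo⁺; ∈-upTo⁻)
  open import Data.List.Relation.Unary.Unique.Propositional.Properties using (upTo⁺)
  open import Data.Product.Base using (_×_; _,_)
  open import Data.Sum.Base as Sum using (_⊎_; inj₁; inj₂)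
  open import Data.Empty using (⊥-elim)
  open import Function.Base using (_∘_)
  open import Relation.Nullary.Decidable using (yes; no; _×-dec_)
  open import Relation.Nullary.Negation using (¬_)
  open import Relation.Binary.PropositionalEquality

  module _ {p : ℕ} where

    ∣-resp : ∀ {a b} → a ≡ b → + p ∣ a → + p ∣ b
    ∣-resp = subst (+ p ∣_)

    mod-refl : ∀ a → a ≡ a [mod p ]
    mod-refl a = divides (+ 0) (cancel a)
      where
      cancel : ∀ a → a - a ≡ + 0
      cancel = solve-∀

    mod-sym : ∀ {a b} → a ≡ b [mod p ] → b ≡ a [mod p ]
    mod-sym {a} {b} a≡b = ∣-resp (flip a b) (∣m⇒∣-m a≡b)
      where
      flip : ∀ a b → - (a - b) ≡ b - a
      flip = solve-∀

    mod-trans : ∀ {a b c} → a ≡ b [mod p ] → b ≡ c [mod p ] → a ≡ c [mod p ]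
    mod-trans {a} {b} {c} a≡b b≡c = ∣-resp (chain a b c) (∣m∣n⇒∣m+n a≡b b≡c)
      where
      chain : ∀ a b c → (a - b) + (b - c) ≡ a - c
      chain = solve-∀

    mod-* : ∀ {a b c d} → a ≡ b [mod p ] → c ≡ d [mod p ] → a * c ≡ b * d [mod p ]
    mod-* {a} {b} {c} {d} a≡b c≡d = ∣-resp (expand a b c d) (∣m∣n⇒∣m+n (∣m⇒∣m*n c a≡b) (∣n⇒∣m*n b c≡d))
      where
      expand : ∀ a b c d → (a - b) * c + b * (c - d) ≡ a * c - b * d
      expand = solve-∀

    residue-≡ : ∀ a .{{_ : NonZero p}} → a ≡ + (a %ℕ p) [mod p ]
    residue-≡ a = divides (a /ℕ p) (trans (cong (_- + (a %ℕ p)) (a≡a%ℕn+[a/ℕn]*n a p)) (cancel (+ (a %ℕ p)) (a /ℕ p) (+ p)))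
      where
      cancel : ∀ r q d → r + q * d - r ≡ q * d
      cancel = solve-∀

    residue-unique : ∀ {m n} → m ℕ.< p → n ℕ.< p → + m ≡ + n [mod p ] → m ≡ n
    residue-unique {m} {n} m<p n<p m≡n =
      ℕ.≤-antisym (one m<p p∣) (one n<p (subst (p ℕ.∣_) (∣m⊖n∣≡∣n⊖m∣ m n) p∣))
      where
      p∣ : p ℕ.∣ abs (m ⊖ n)
      p∣ = subst (λ z → p ℕ.∣ abs z) (m-n≡m⊖n m n) (∣⇒∣ᵤ m≡n)
      one : ∀ {m n} → m ℕ.< p → p ℕ.∣ abs (m ⊖ n) → m ℕ.≤ n
      one {m} {n} m<p p∣ with ℕ.≤-total m n
      ... | inj₁ m≤n = m≤n
      ... | inj₂ n≤m = ℕ.m∸n≡0⇒m≤n (small (ℕ.≤-<-trans (ℕ.m∸n≤m m n) m<p) (subst (λ z → p ℕ.∣ abs z) (⊖-≥ n≤m) p∣))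
        where
        small : ∀ {k} → k ℕ.< p → p ℕ.∣ k → k ≡ 0
        small {0}     k<p p∣k = refl
        small {suc k} k<p p∣k = ⊥-elim (ℕ.>⇒∤ k<p p∣k)

  module _ {p : ℕ} (p-prime : Prime p) where

    private instance
      p≢0 : NonZero p
      p≢0 = prime⇒nonZero p-prime

    euclid : ∀ a b → + p ∣ a * b → (+ p ∣ a) ⊎ (+ p ∣ b)
    euclid a b p∣ab = Sum.map ∣ᵤ⇒∣ ∣ᵤ⇒∣ (euclidsLemma (abs a) (abs b) p-prime (subst (p ℕ.∣_) (abs-* a b) (∣⇒∣ᵤ p∣ab)))

    mod-*-cancelˡ : ∀ a {b c} → ¬ (+ p ∣ a) → a * b ≡ a * c [mod p ] → b ≡ c [mod p ]
    mod-*-cancelˡ a {b} {c} p∤a ab≡ac with euclid a (b - c) (∣-resp (factor a b c) ab≡ac)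
      where
      factor : ∀ a b c → a * b - a * c ≡ a * (b - c)
      factor = solve-∀
    ... | inj₁ p∣a = ⊥-elim (p∤a p∣a)
    ... | inj₂ b≡c = b≡c

    incidences : List (ℤ × ℤ) → ℕ → ℕ → ℕ
    incidences B u t = ∑[ (x , y) ∈ B ] ⟦ + p ∣? + u * x - y - + t ⟧

    -- Pairs are ordered and include each list entry with itself, as the expansion of a squared sum
    -- requires.
    coincidences : List (ℤ × ℤ) → ℕ
    coincidences B = ∑[ (x , y) ∈ B ] ∑[ (x′ , y′) ∈ B ] ⟦ (+ p ∣? x - x′) ×-dec (+ p ∣? y - y′) ⟧

    private
      F : List ℕ
      F = upTo p

      ∑F-const : ∀ c → ∑[ t ∈ F ] c ≡ p ℕ.* c
      ∑F-const c = trans (∑-const F c) (cong (ℕ._* c) (length-upTo p))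

      shift : ∀ {a t t′} → + p ∣ a - + t → + p ∣ a - + t′ → + t ≡ + t′ [mod p ]
      shift {a} {t} e e′ = mod-trans {a = + t} {b = a} (mod-sym {a = a} e) e′

      at-most-one-t : ∀ a → ∑[ t ∈ F ] ⟦ + p ∣? a - + t ⟧ ℕ.≤ 1
      at-most-one-t a = ∑-at-most-one (λ t → + p ∣? a - + t) (upTo⁺ p) λ t∈ t′∈ e e′ →
        residue-unique (∈-upTo⁻ t∈) (∈-upTo⁻ t′∈) (shift {a} e e′)

      some-t : ∀ a → 1 ℕ.≤ ∑[ t ∈ F ] ⟦ + p ∣? a - + t ⟧
      some-t a = ℕ.≤-trans (⟦⟧-true (+ p ∣? a - + (a %ℕ p)) (residue-≡ a))
        (∑-term (λ t → ⟦ + p ∣? a - + t ⟧) (∈-upTo⁺ (n%ℕd<d a p)))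

      -- For u a ≡ b there are three cases: a invertible gives at most one u; a ≡ 0 with b ≢ 0 gives
      -- none; a ≡ b ≡ 0 gives all p. The last case is the one that counts coincident points.
      common-slopes : ∀ a b → ∑[ u ∈ F ] ⟦ + p ∣? + u * a - b ⟧ ℕ.≤ 1 ℕ.+ p ℕ.* ⟦ (+ p ∣? a) ×-dec (+ p ∣? b) ⟧
      common-slopes a b with + p ∣? a | + p ∣? b
      ... | yes p∣a | yes p∣b = ℕ.≤-trans
        (ℕ.≤-trans (∑-mono F (λ {u} _ → ⟦⟧≤1 (+ p ∣? + u * a - b))) (ℕ.≤-reflexive (∑F-const 1)))
        (ℕ.m≤n+m (p ℕ.* 1) 1)
      ... | yes p∣a | no p∤b = ℕ.≤-trans
        (ℕ.≤-trans (∑-mono F (λ {u} _ → ℕ.≤-reflexive (⟦⟧-false (+ p ∣? + u * a - b) (p∤b ∘ recover u))))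
                   (ℕ.≤-reflexive (trans (∑F-const 0) (ℕ.*-zeroʳ p)))) ℕ.z≤n
        where
        sub : ∀ u a b → u * a - (u * a - b) ≡ b
        sub = solve-∀
        recover : ∀ u → + p ∣ + u * a - b → + p ∣ b
        recover u p∣ = ∣-resp (sub (+ u) a b) (∣m∣n⇒∣m-n (∣n⇒∣m*n (+ u) p∣a) p∣)
      ... | no p∤a | _ = ℕ.≤-trans
        (∑-at-most-one (λ u → + p ∣? + u * a - b) (upTo⁺ p) λ {u} {u′} u∈ u′∈ e e′ →
          residue-unique (∈-upTo⁻ u∈) (∈-upTo⁻ u′∈)
            (mod-*-cancelˡ a p∤a (∣-resp (sub (+ u) (+ u′) a b) (∣m∣n⇒∣m-n e e′))))
        (ℕ.s≤s ℕ.z≤n)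
        where
        sub : ∀ u u′ a b → (u * a - b) - (u′ * a - b) ≡ a * u - a * u′
        sub = solve-∀

    module _ (B : List (ℤ × ℤ)) where

      private
        L = length B
        E = coincidences B
        f = incidences B

      -- For every slope each point lies on some line. The lower bound is the useful direction,
      -- because the first moment enters the variance with a minus sign.
      first-moment : L ℕ.* p ℕ.≤ ∑[ u ∈ F ] ∑[ t ∈ F ] f u t
      first-moment = begin
        L ℕ.* p                                             ≡⟨ ∑-const B p ⟨
        ∑[ b ∈ B ] p                                        ≡⟨ ∑-cong B (λ _ → trans (∑F-const 1) (ℕ.*-identityʳ p)) ⟨
        ∑[ b ∈ B ] ∑[ u ∈ F ] 1                             ≤⟨ ∑-mono B (λ {(x , y)} _ → ∑-mono F (λ {u} _ → some-t (+ u * x - y))) ⟩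
        ∑[ (x , y) ∈ B ] ∑[ u ∈ F ] ∑[ t ∈ F ] ⟦ + p ∣? + u * x - y - + t ⟧ ≡⟨ ∑-swap B F _ ⟩
        ∑[ u ∈ F ] ∑[ (x , y) ∈ B ] ∑[ t ∈ F ] ⟦ + p ∣? + u * x - y - + t ⟧ ≡⟨ ∑-cong F (λ u → ∑-swap B F _) ⟩
        ∑[ u ∈ F ] ∑[ t ∈ F ] f u t                         ∎
        where open ℕ.≤-Reasoning

      -- Squaring counts pairs of points on a common line. For fixed u the intercept is determined
      -- by the first point, leaving u (x - x′) ≡ y - y′; summed over u this gives 1 for each pair
      -- and at most p more for a coincident one.
      second-moment : ∑[ u ∈ F ] ∑[ t ∈ F ] f u t ℕ.* f u t ℕ.≤ L ℕ.* L ℕ.+ p ℕ.* E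
      second-moment = begin
        ∑[ u ∈ F ] ∑[ t ∈ F ] f u t ℕ.* f u t
          ≡⟨ ∑-cong F (λ u → ∑-cong F (λ t → ∑-*-∑ B (λ b → on u t b) B (λ b → on u t b))) ⟩
        ∑[ u ∈ F ] ∑[ t ∈ F ] ∑[ b ∈ B ] ∑[ b′ ∈ B ] on u t b ℕ.* on u t b′
          ≡⟨ ∑-cong F (λ u → trans (∑-swap F B _) (∑-cong B (λ b → ∑-swap F B _))) ⟩
        ∑[ u ∈ F ] ∑[ b ∈ B ] ∑[ b′ ∈ B ] ∑[ t ∈ F ] on u t b ℕ.* on u t b′
          ≤⟨ ∑-mono F (λ {u} _ → ∑-mono B (λ {b} _ → ∑-mono B (λ {b′} _ → pair u b b′))) ⟩
        ∑[ u ∈ F ] ∑[ b ∈ B ] ∑[ b′ ∈ B ] meet u b b′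
          ≡⟨ trans (∑-swap F B _) (∑-cong B (λ b → ∑-swap F B _)) ⟩
        ∑[ b ∈ B ] ∑[ b′ ∈ B ] ∑[ u ∈ F ] meet u b b′
          ≤⟨ ∑-mono B (λ {(x , y)} _ → ∑-mono B (λ {(x′ , y′)} _ → common-slopes (x - x′) (y - y′))) ⟩
        ∑[ b ∈ B ] ∑[ b′ ∈ B ] (1 ℕ.+ p ℕ.* same b b′)
          ≡⟨ ∑-cong B (λ b → trans (∑-+ B _ _) (cong₂ ℕ._+_ (trans (∑-const B 1) (ℕ.*-identityʳ L)) (∑-*ˡ p B _))) ⟩
        ∑[ b ∈ B ] (L ℕ.+ p ℕ.* (∑[ b′ ∈ B ] same b b′))
          ≡⟨ trans (∑-+ B _ _) (cong₂ ℕ._+_ (∑-const B L) (∑-*ˡ p B _)) ⟩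
        L ℕ.* L ℕ.+ p ℕ.* E ∎
        where
        open ℕ.≤-Reasoning
        on : ℕ → ℕ → ℤ × ℤ → ℕ
        on u t (x , y) = ⟦ + p ∣? + u * x - y - + t ⟧
        meet : ℕ → ℤ × ℤ → ℤ × ℤ → ℕ
        meet u (x , y) (x′ , y′) = ⟦ + p ∣? + u * (x - x′) - (y - y′) ⟧
        same : ℤ × ℤ → ℤ × ℤ → ℕ
        same (x , y) (x′ , y′) = ⟦ (+ p ∣? x - x′) ×-dec (+ p ∣? y - y′) ⟧
        sub : ∀ u x y t x′ y′ → (u * x - y - t) - (u * x′ - y′ - t) ≡ u * (x - x′) - (y - y′)
        sub = solve-∀
        pair : ∀ u b b′ → ∑[ t ∈ F ] on u t b ℕ.* on u t b′ ℕ.≤ meet u b b′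
        pair u b@(x , y) b′@(x′ , y′) = begin
          ∑[ t ∈ F ] on u t b ℕ.* on u t b′
            ≤⟨ ∑-mono F (λ {t} _ → ⟦⟧-* (+ p ∣? + u * x - y - + t) (+ p ∣? + u * x′ - y′ - + t)
                 (+ p ∣? + u * (x - x′) - (y - y′)) λ e e′ → ∣-resp (sub (+ u) x y (+ t) x′ y′) (∣m∣n⇒∣m-n e e′)) ⟩
          ∑[ t ∈ F ] meet u b b′ ℕ.* on u t b    ≡⟨ ∑-*ˡ (meet u b b′) F _ ⟩
          meet u b b′ ℕ.* (∑[ t ∈ F ] on u t b)  ≤⟨ ℕ.*-monoʳ-≤ (meet u b b′) (at-most-one-t (+ u * x - y)) ⟩
          meet u b b′ ℕ.* 1                      ≡⟨ ℕ.*-identityʳ (meet u b b′) ⟩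
          meet u b b′                            ∎

      -- Two non-coincident points lie on a common line no more often than independent events would.
      variance : ∑[ u ∈ F ] ∑[ t ∈ F ] ∣ p ℕ.* f u t - L ∣ ℕ.* ∣ p ℕ.* f u t - L ∣ ℕ.≤ p ℕ.* p ℕ.* p ℕ.* E
      -- The expansion (p f - L)² = p² f² - 2 p L f + L² is transposed so that everything stays in
      -- ℕ; the term finally cancelled is the cross term with the sum of f replaced by its lower
      -- bound L p.
      variance = ℕ.+-cancelʳ-≤ (2 ℕ.* p ℕ.* L ℕ.* (L ℕ.* p)) V _ (begin
        V ℕ.+ 2 ℕ.* p ℕ.* L ℕ.* (L ℕ.* p)
          ≤⟨ ℕ.+-monoʳ-≤ V (ℕ.*-monoʳ-≤ (2 ℕ.* p ℕ.* L) first-moment) ⟩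
        V ℕ.+ 2 ℕ.* p ℕ.* L ℕ.* (∑[ u ∈ F ] ∑[ t ∈ F ] f u t)
          ≡⟨ cong (V ℕ.+_) (trans (∑-cong F (λ u → ∑-*ˡ (2 ℕ.* p ℕ.* L) F _)) (∑-*ˡ (2 ℕ.* p ℕ.* L) F _)) ⟨
        V ℕ.+ (∑[ u ∈ F ] ∑[ t ∈ F ] 2 ℕ.* p ℕ.* L ℕ.* f u t)
          ≡⟨ trans (∑-cong F (λ u → ∑-+ F _ _)) (∑-+ F _ _) ⟨
        ∑[ u ∈ F ] ∑[ t ∈ F ] (∣ p ℕ.* f u t - L ∣ ℕ.* ∣ p ℕ.* f u t - L ∣ ℕ.+ 2 ℕ.* p ℕ.* L ℕ.* f u t)
          ≡⟨ ∑-cong F (λ u → ∑-cong F (λ t → square p L (f u t))) ⟩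
        ∑[ u ∈ F ] ∑[ t ∈ F ] (p ℕ.* p ℕ.* (f u t ℕ.* f u t) ℕ.+ L ℕ.* L)
          ≡⟨ trans (∑-cong F (λ u → trans (∑-+ F _ _) (cong₂ ℕ._+_ (∑-*ˡ (p ℕ.* p) F _) (∑F-const (L ℕ.* L)))))
               (trans (∑-+ F _ _) (cong₂ ℕ._+_ (∑-*ˡ (p ℕ.* p) F _) (∑F-const (p ℕ.* (L ℕ.* L))))) ⟩
        p ℕ.* p ℕ.* (∑[ u ∈ F ] ∑[ t ∈ F ] f u t ℕ.* f u t) ℕ.+ p ℕ.* (p ℕ.* (L ℕ.* L))
          ≤⟨ ℕ.+-monoˡ-≤ _ (ℕ.*-monoʳ-≤ (p ℕ.* p) second-moment) ⟩
        p ℕ.* p ℕ.* (L ℕ.* L ℕ.+ p ℕ.* E) ℕ.+ p ℕ.* (p ℕ.* (L ℕ.* L))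
          ≡⟨ collect p L E ⟩
        p ℕ.* p ℕ.* p ℕ.* E ℕ.+ 2 ℕ.* p ℕ.* L ℕ.* (L ℕ.* p) ∎)
        where
        open ℕ.≤-Reasoning
        V = ∑[ u ∈ F ] ∑[ t ∈ F ] ∣ p ℕ.* f u t - L ∣ ℕ.* ∣ p ℕ.* f u t - L ∣
        collect : ∀ p L E → p ℕ.* p ℕ.* (L ℕ.* L ℕ.+ p ℕ.* E) ℕ.+ p ℕ.* (p ℕ.* (L ℕ.* L)) ≡
                            p ℕ.* p ℕ.* p ℕ.* E ℕ.+ 2 ℕ.* p ℕ.* L ℕ.* (L ℕ.* p)
        collect = ℕ-Solver.solve-∀
        gap-square : ∀ a d → d ℕ.* d ℕ.+ 2 ℕ.* a ℕ.* (a ℕ.+ d) ≡ (a ℕ.+ d) ℕ.* (a ℕ.+ d) ℕ.+ a ℕ.* a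
        gap-square = ℕ-Solver.solve-∀
        absdiff-square : ∀ a b → ∣ a - b ∣ ℕ.* ∣ a - b ∣ ℕ.+ 2 ℕ.* a ℕ.* b ≡ a ℕ.* a ℕ.+ b ℕ.* b
        absdiff-square a b with ℕ.≤-total a b
        ... | inj₁ a≤b rewrite ℕ.m≤n⇒∣m-n∣≡n∸m a≤b = trans
          (subst (λ z → (b ℕ.∸ a) ℕ.* (b ℕ.∸ a) ℕ.+ 2 ℕ.* a ℕ.* z ≡ z ℕ.* z ℕ.+ a ℕ.* a) (ℕ.m+[n∸m]≡n a≤b) (gap-square a (b ℕ.∸ a)))
          (ℕ.+-comm (b ℕ.* b) (a ℕ.* a))
        ... | inj₂ b≤a rewrite ℕ.m≤n⇒∣n-m∣≡n∸m b≤a = trans (cong ((a ℕ.∸ b) ℕ.* (a ℕ.∸ b) ℕ.+_) (flip a b))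
          (subst (λ z → (a ℕ.∸ b) ℕ.* (a ℕ.∸ b) ℕ.+ 2 ℕ.* b ℕ.* z ≡ z ℕ.* z ℕ.+ b ℕ.* b) (ℕ.m+[n∸m]≡n b≤a) (gap-square b (a ℕ.∸ b)))
          where
          flip : ∀ a b → 2 ℕ.* a ℕ.* b ≡ 2 ℕ.* b ℕ.* a
          flip = ℕ-Solver.solve-∀
        square : ∀ p L x → ∣ p ℕ.* x - L ∣ ℕ.* ∣ p ℕ.* x - L ∣ ℕ.+ 2 ℕ.* p ℕ.* L ℕ.* x ≡ p ℕ.* p ℕ.* (x ℕ.* x) ℕ.+ L ℕ.* L
        square p L x = trans (cong (∣ p ℕ.* x - L ∣ ℕ.* ∣ p ℕ.* x - L ∣ ℕ.+_) (arrange p L x))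
                             (trans (absdiff-square (p ℕ.* x) L) (cong (ℕ._+ L ℕ.* L) (arrange′ p x)))
          where
          arrange : ∀ p L x → 2 ℕ.* p ℕ.* L ℕ.* x ≡ 2 ℕ.* (p ℕ.* x) ℕ.* L
          arrange = ℕ-Solver.solve-∀
          arrange′ : ∀ p x → p ℕ.* x ℕ.* (p ℕ.* x) ≡ p ℕ.* p ℕ.* (x ℕ.* x)
          arrange′ = ℕ-Solver.solve-∀

-- Integer powers of a primitive root modulo p.

module Powers where

  open Incidences
  open import Data.Nat.Base as ℕ using (ℕ; zero; suc; NonZero)
  import Data.Nat.Properties as ℕ
  import Data.Nat.Divisibility as ℕ
  open import Data.Nat.DivMod using (m≡m%n+[m/n]*n; m%n<n) renaming (_/_ to _/ℕ_; _%_ to _%ℕ_)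
  open import Data.Nat.Primality using (Prime; prime⇒nonZero; prime⇒nonTrivial)
  open import Data.Nat.Coprimality using (prime⇒coprime) renaming (sym to coprime-sym)
  open import Data.Integer.Base using (ℤ; +_; -[1+_]; 0ℤ; 1ℤ; _+_; _*_; _-_; -_; _^_)
  open import Data.Integer.Properties using (^-distribˡ-+-*; ^-*-assoc; *-identityʳ; *-identityˡ)
  open import Data.Integer.Divisibility.Signed using (_∣_; ∣⇒∣ᵤ; ∣m∣n⇒∣m-n; ∣n⇒∣m*n; ∣m⇒∣m*n)
  open import Data.Integer.Tactic.RingSolver using (solve-∀)
  open import Data.Fin.Base using (Fin; toℕ; fromℕ<)
  open import Data.Fin.Properties using (pigeonhole; toℕ<n; toℕ-fromℕ<)
  open import Data.Product.Base using (_,_; proj₁; proj₂)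
  open import Data.Sum.Base using (inj₁; inj₂)
  open import Data.Empty using (⊥; ⊥-elim)
  open import Relation.Nullary.Negation using (¬_)
  open import Relation.Binary.PropositionalEquality

  mod-^ : ∀ {p a b} n → a ≡ b [mod p ] → a ^ n ≡ b ^ n [mod p ]
  mod-^ zero    a≡b = mod-refl 1ℤ
  mod-^ {a = a} {b} (suc n) a≡b = mod-* {a = a} {b} {a ^ n} {b ^ n} a≡b (mod-^ {a = a} {b} n a≡b)

  1^n≡1 : ∀ n → 1ℤ ^ n ≡ 1ℤ
  1^n≡1 zero    = refl
  1^n≡1 (suc n) = trans (*-identityˡ (1ℤ ^ n)) (1^n≡1 n)

  module _ {p : ℕ} (p-prime : Prime p) {g : ℤ} (root : PrimitiveRoot p g) where

    open PrimitiveRoot root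

    private
      instance
        p≢0 : NonZero p
        p≢0 = prime⇒nonZero p-prime

      g⁻¹ : ℤ
      g⁻¹ = proj₁ (modularInverse p g coprime)

      gg⁻¹≡1 : g * g⁻¹ ≡ 1ℤ [mod p ]
      gg⁻¹≡1 = proj₂ (modularInverse p g coprime)

      1<p : 1 ℕ.< p
      1<p = ℕ.nonTrivial⇒n>1 p {{prime⇒nonTrivial p-prime}}

      p∤1 : ¬ (+ p ∣ 1ℤ)
      p∤1 p∣1 = ℕ.>⇒∤ 1<p (∣⇒∣ᵤ p∣1)

    pow : ℤ → ℤ
    pow = power g g⁻¹

    p∤g : ¬ (+ p ∣ g)
    p∤g p∣g = p∤1 (∣-resp (sub (g * g⁻¹)) (∣m∣n⇒∣m-n (∣m⇒∣m*n g⁻¹ p∣g) gg⁻¹≡1))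
      where
      sub : ∀ a → a - (a - 1ℤ) ≡ 1ℤ
      sub = solve-∀

    p∤g⁻¹ : ¬ (+ p ∣ g⁻¹)
    p∤g⁻¹ p∣g⁻¹ = p∤1 (∣-resp (sub (g * g⁻¹)) (∣m∣n⇒∣m-n (∣n⇒∣m*n g p∣g⁻¹) gg⁻¹≡1))
      where
      sub : ∀ a → a - (a - 1ℤ) ≡ 1ℤ
      sub = solve-∀

    p∤^ : ∀ a n → ¬ (+ p ∣ a) → ¬ (+ p ∣ a ^ n)
    p∤^ a zero    p∤a p∣ = p∤1 p∣
    p∤^ a (suc n) p∤a p∣ with euclid p-prime a (a ^ n) p∣
    ... | inj₁ p∣a  = p∤a p∣a
    ... | inj₂ p∣aⁿ = p∤^ a n p∤a p∣aⁿ

    p∤pow : ∀ x → ¬ (+ p ∣ pow x)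
    p∤pow (+ n)    = p∤^ g n p∤g
    p∤pow -[1+ n ] = p∤^ g⁻¹ (suc n) p∤g⁻¹

    -- The inverse is at work only for negative x, where one factor g cancels one factor g⁻¹; the
    -- exponent -1 is separate because 1 + x then crosses to the non-negative branch of `power`.
    pow-suc : ∀ x → g * pow x ≡ pow (1ℤ + x) [mod p ]
    pow-suc (+ n)            = mod-refl (g * g ^ n)
    pow-suc -[1+ zero ]      = subst (λ z → g * z ≡ 1ℤ [mod p ]) (sym (*-identityʳ g⁻¹)) gg⁻¹≡1
    pow-suc -[1+ suc n ]     = ∣-resp (factor g g⁻¹ (g⁻¹ ^ suc n)) (∣m⇒∣m*n (g⁻¹ ^ suc n) gg⁻¹≡1)
      where
      factor : ∀ a b c → (a * b - 1ℤ) * c ≡ a * (b * c) - c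
      factor = solve-∀

    pow-+ : ∀ s x → g ^ s * pow x ≡ pow (+ s + x) [mod p ]
    pow-+ zero    x = subst₂ (λ a b → a ≡ pow b [mod p ]) (sym (*-identityˡ (pow x))) (shift x) (mod-refl (pow x))
      where
      shift : ∀ x → x ≡ 0ℤ + x
      shift = solve-∀
    pow-+ (suc s) x = subst₂ (λ a b → a ≡ pow b [mod p ]) (assoc g (g ^ s) (pow x)) (shift (+ s) x)
      (mod-trans {a = g * (g ^ s * pow x)} {g * pow (+ s + x)}
        (mod-* {a = g} {g} {g ^ s * pow x} (mod-refl g) (pow-+ s x)) (pow-suc (+ s + x)))
      where
      assoc : ∀ a b c → a * (b * c) ≡ (a * b) * c
      assoc = solve-∀
      shift : ∀ s x → 1ℤ + (s + x) ≡ (1ℤ + s) + x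
      shift = solve-∀

    -- If g^d ≡ 1 then the exponents modulo d take care of all p − 1 non-zero residues.
    order : ∀ d .{{_ : NonZero d}} → g ^ d ≡ 1ℤ [mod p ] → p ℕ.≤ suc d
    order d gᵈ≡1 = ℕ.≮⇒≥ λ d+1<p → collision (pigeonhole (ℕ.pred-mono-≤ d+1<p) exponent)
      where
      residue : Fin (ℕ.pred p) → ℕ
      residue i = suc (toℕ i)
      residue<p : ∀ i → residue i ℕ.< p
      residue<p i = subst (residue i ℕ.<_) (ℕ.suc-pred p) (ℕ.s≤s (toℕ<n i))
      generated : ∀ i → _
      generated i = generates (+ residue i) (coprime-sym (prime⇒coprime p-prime (residue<p i)))
      exponent : Fin (ℕ.pred p) → Fin d
      exponent i = fromℕ< (m%n<n (proj₁ (generated i)) d)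
      reduce : ∀ k → g ^ (k %ℕ d) ≡ g ^ k [mod p ]
      reduce k = subst₂ (λ a b → a ≡ b [mod p ]) (*-identityʳ (g ^ (k %ℕ d)))
        (trans (trans (cong (g ^ (k %ℕ d) *_) (trans (^-*-assoc g d (k /ℕ d)) (cong (g ^_) (ℕ.*-comm d (k /ℕ d)))))
                      (sym (^-distribˡ-+-* g (k %ℕ d) (k /ℕ d ℕ.* d))))
               (cong (g ^_) (sym (m≡m%n+[m/n]*n k d))))
        (mod-* {a = g ^ (k %ℕ d)} {g ^ (k %ℕ d)} {1ℤ} {(g ^ d) ^ (k /ℕ d)} (mod-refl (g ^ (k %ℕ d)))
          (subst (λ z → z ≡ (g ^ d) ^ (k /ℕ d) [mod p ]) (1^n≡1 (k /ℕ d))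
            (mod-^ {a = 1ℤ} {g ^ d} (k /ℕ d) (mod-sym {a = g ^ d} gᵈ≡1))))
      value : ∀ i → g ^ toℕ (exponent i) ≡ + residue i [mod p ]
      value i = subst (λ e → g ^ e ≡ + residue i [mod p ]) (sym (toℕ-fromℕ< (m%n<n (proj₁ (generated i)) d)))
        (mod-trans {a = g ^ (proj₁ (generated i) %ℕ d)} {g ^ proj₁ (generated i)} {+ residue i}
          (reduce (proj₁ (generated i))) (proj₂ (generated i)))
      collision : _ → ⊥
      collision (i , j , i<j , eq) = ℕ.<⇒≢ i<j (ℕ.suc-injective
        (residue-unique (residue<p i) (residue<p j)
          (mod-trans {a = + residue i} {g ^ toℕ (exponent j)}
            (mod-sym {a = g ^ toℕ (exponent j)} {+ residue i}
              (subst (λ e → g ^ toℕ e ≡ + residue i [mod p ]) eq (value i))) (value j))))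

    -- Cancelling the invertible `pow (c + + i)` leaves g^(j - i) ≡ 1. The hypothesis says j - i < p
    -- - 1, so by `order` the difference cannot be positive.
    pow-injective : ∀ c {i j} → i ℕ.≤ j → suc j ℕ.< i ℕ.+ p → pow (c + + i) ≡ pow (c + + j) [mod p ] → i ≡ j
    pow-injective c {i} {j} i≤j j<i+p eq with j ℕ.∸ i in j∸i≡d
    ... | zero  = ℕ.≤-antisym i≤j (ℕ.m∸n≡0⇒m≤n j∸i≡d)
    ... | suc d = ⊥-elim (ℕ.<⇒≱ sd<p (order (suc d) gᵈ≡1))
      where
      j≡i+d : j ≡ i ℕ.+ suc d
      j≡i+d = trans (sym (ℕ.m+[n∸m]≡n i≤j)) (cong (i ℕ.+_) j∸i≡d)
      sd<p : suc (suc d) ℕ.< p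
      sd<p = ℕ.+-cancelˡ-< i _ _ (subst (ℕ._< i ℕ.+ p) (trans (cong suc j≡i+d) (sym (ℕ.+-suc i (suc d)))) j<i+p)
      shift : ∀ c i d → d + (c + i) ≡ c + (i + d)
      shift = solve-∀
      x = c + + i
      gᵈx≡x : g ^ suc d * pow x ≡ 1ℤ * pow x [mod p ]
      gᵈx≡x = subst (λ z → g ^ suc d * pow x ≡ z [mod p ]) (sym (*-identityˡ (pow x)))
        (mod-trans {a = g ^ suc d * pow x} {pow (c + + j)}
          (subst (λ z → g ^ suc d * pow x ≡ pow z [mod p ])
            (trans (shift c (+ i) (+ suc d)) (cong (λ k → c + + k) (sym j≡i+d))) (pow-+ (suc d) x))
          (mod-sym {a = pow x} eq))
      comm : ∀ a b x → a * x - b * x ≡ x * a - x * b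
      comm = solve-∀
      gᵈ≡1 : g ^ suc d ≡ 1ℤ [mod p ]
      gᵈ≡1 = mod-*-cancelˡ p-prime (pow x) {g ^ suc d} {1ℤ} (p∤pow x) (∣-resp (comm (g ^ suc d) 1ℤ (pow x)) gᵈx≡x)

-- Solutions of g^x ≡ y in boxes, and the variance over translates.

module Boxes where

  open Sums
  open Incidences
  open Powers
  open import Data.Nat.Base as ℕ using (ℕ; suc; NonZero; ∣_-_∣; _∸_)
  import Data.Nat.Properties as ℕ
  open import Data.Nat.Primality using (Prime; prime⇒nonZero)
  open import Data.Integer.Base using (ℤ; +_; _+_; _*_; _-_; _^_)
  open import Data.Integer.DivMod using (_%ℕ_; n%ℕd<d)
  open import Data.Integer.Divisibility.Signed using (_∣_; _∣?_; ∣m∣n⇒∣m+n; ∣m∣n⇒∣m-n)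
  open import Data.Integer.Tactic.RingSolver using (solve-∀)
  open import Data.List.Base using (List; upTo; length; map; cartesianProduct)
  open import Data.List.Properties using (length-upTo)
  open import Data.List.Membership.Propositional.Properties using (∈-upTo⁺; ∈-upTo⁻)
  open import Data.List.Relation.Unary.Unique.Propositional.Properties using (upTo⁺)
  open import Data.Product.Base using (_×_; _,_)
  open import Data.Sum.Base using (inj₁; inj₂)
  open import Function.Base using (_∘_)
  open import Relation.Nullary.Decidable using (_×-dec_)
  open import Relation.Binary.PropositionalEquality hiding (J)

  ∑-window : ∀ {d k n} → d ℕ.+ k ℕ.≤ n → (f : ℕ → ℕ) → ∑[ i ∈ upTo k ] f (d ℕ.+ i) ℕ.≤ ∑ (upTo n) f
  ∑-window {d} {k} d+k≤n = ∑-injection ℕ._≟_ (d ℕ.+_) (upTo⁺ k)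
    (λ i∈ → ∈-upTo⁺ (ℕ.<-≤-trans (ℕ.+-monoʳ-< d (∈-upTo⁻ i∈)) d+k≤n))
    (λ _ _ → ℕ.+-cancelˡ-≡ d _ _)

  -- The range is covered by the windows [0, m) and [m, 2m). Injectivity is asked for a window at
  -- arbitrary a, so that one hypothesis serves both.
  ∑-two-windows : ∀ {P : ℕ → Set} (P? : ∀ i → _) {m n} → n ℕ.≤ m ℕ.+ m →
                  (∀ {a i j} → a ℕ.≤ i → i ℕ.≤ j → j ℕ.< a ℕ.+ m → P i → P j → i ≡ j) →
                  ∑ (upTo n) (⟦_⟧ ∘ P?) ℕ.≤ 2
  ∑-two-windows {P} P? {m} {n} n≤2m inj = ∑-at-most-two P? (ℕ._<? m) (upTo⁺ n)
    (λ _ _ p q i<m j<m → both ℕ.z≤n ℕ.z≤n i<m j<m p q)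
    (λ i∈ j∈ p q i≮m j≮m → both (ℕ.≮⇒≥ i≮m) (ℕ.≮⇒≥ j≮m)
      (ℕ.<-≤-trans (∈-upTo⁻ i∈) n≤2m) (ℕ.<-≤-trans (∈-upTo⁻ j∈) n≤2m) p q)
    where
    both : ∀ {a i j} → a ℕ.≤ i → a ℕ.≤ j → i ℕ.< a ℕ.+ m → j ℕ.< a ℕ.+ m → P i → P j → i ≡ j
    both {a} {i} {j} a≤i a≤j i<a+m j<a+m p q with ℕ.≤-total i j
    ... | inj₁ i≤j = inj a≤i i≤j j<a+m p q
    ... | inj₂ j≤i = sym (inj a≤j j≤i i<a+m q p)

  module _ {p : ℕ} (p-prime : Prime p) {g : ℤ} (root : PrimitiveRoot p g) where

    private
      instance
        p≢0 : NonZero p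
        p≢0 = prime⇒nonZero p-prime

      pw : ℤ → ℤ
      pw = pow p-prime root

    -- Counts pairs (x, y), not exponents x, so that it is additive in both sides and can be
    -- enlarged in y as well. Offsets from a corner make translation a change of `a` and `b` alone.
    box : ℤ → ℕ → ℤ → ℕ → ℕ
    box a k b n = ∑[ i ∈ upTo k ] ∑[ j ∈ upTo n ] ⟦ + p ∣? pw (a + + i) - (b + + j) ⟧

    box-mono : ∀ {a k b n a′ k′ b′ n′} d e → a ≡ a′ + + d → d ℕ.+ k ℕ.≤ k′ → b ≡ b′ + + e → e ℕ.+ n ℕ.≤ n′ →
               box a k b n ℕ.≤ box a′ k′ b′ n′
    box-mono {k = k} {n = n} {a′} {k′} {b′} {n′} d e refl d+k≤k′ refl e+n≤n′ = begin
      ∑[ i ∈ upTo k ] ∑[ j ∈ upTo n ] ⟦ + p ∣? pw (a′ + + d + + i) - (b′ + + e + + j) ⟧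
        ≡⟨ ∑-cong (upTo k) (λ i → ∑-cong (upTo n) (λ j →
             cong₂ (λ x y → ⟦ + p ∣? pw x - y ⟧) (assoc a′ (+ d) (+ i)) (assoc b′ (+ e) (+ j)))) ⟩
      ∑[ i ∈ upTo k ] ∑[ j ∈ upTo n ] ⟦ + p ∣? pw (a′ + + (d ℕ.+ i)) - (b′ + + (e ℕ.+ j)) ⟧
        ≤⟨ ∑-mono (upTo k) (λ _ → ∑-window {e} e+n≤n′ _) ⟩
      ∑[ i ∈ upTo k ] ∑[ j ∈ upTo n′ ] ⟦ + p ∣? pw (a′ + + (d ℕ.+ i)) - (b′ + + j) ⟧
        ≤⟨ ∑-window {d} d+k≤k′ (λ i → ∑[ j ∈ upTo n′ ] ⟦ + p ∣? pw (a′ + + i) - (b′ + + j) ⟧) ⟩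
      box a′ k′ b′ n′ ∎
      where
      open ℕ.≤-Reasoning
      assoc : ∀ a d i → a + d + i ≡ a + (d + i)
      assoc = solve-∀

    module _ (a : ℤ) (K : ℕ) (b : ℤ) (N : ℕ) where

      private
        points : List (ℤ × ℤ)
        points = cartesianProduct (map (λ i → pw (a + + i)) (upTo K)) (map (λ j → b + + j) (upTo N))

        ∑-points : (f : ℤ × ℤ → ℕ) → ∑ points f ≡ ∑[ i ∈ upTo K ] ∑[ j ∈ upTo N ] f (pw (a + + i) , b + + j)
        ∑-points f = trans (∑-cartesianProduct (map _ (upTo K)) (map _ (upTo N)) f)
          (trans (∑-map _ (upTo K) _) (∑-cong (upTo K) (λ i → ∑-map _ (upTo N) _)))

        length-points : length points ≡ K ℕ.* N
        length-points = begin
          length points                             ≡⟨ trans (∑-const points 1) (ℕ.*-identityʳ _) ⟨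
          ∑[ b ∈ points ] 1                         ≡⟨ ∑-points (λ _ → 1) ⟩
          ∑[ i ∈ upTo K ] ∑[ j ∈ upTo N ] 1         ≡⟨ ∑-cong (upTo K) (λ _ → trans (∑-const (upTo N) 1) (ℕ.*-identityʳ _)) ⟩
          ∑[ i ∈ upTo K ] length (upTo N)           ≡⟨ ∑-const (upTo K) (length (upTo N)) ⟩
          length (upTo K) ℕ.* length (upTo N)       ≡⟨ cong₂ ℕ._*_ (length-upTo K) (length-upTo N) ⟩
          K ℕ.* N                                   ∎
          where open ≡-Reasoning

        -- Multiplication by g^s moves the exponent by s, and the intercept t moves y. The slope is
        -- reduced modulo p because slopes are summed over `upTo p`.
        incidences-points : ∀ s t → incidences p-prime points (g ^ s %ℕ p) t ≡ box (a + + s) K (b + + t) N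
        incidences-points s t = trans (∑-points _) (∑-cong (upTo K) λ i → ∑-cong (upTo N) λ j →
          ⟦⟧-cong _ _
            (λ e → ∣-resp (add (u * pw (a + + i)) (pw (a + + s + + i)) (b + + j) (+ t) b (+ j)) (∣m∣n⇒∣m-n e (near i)))
            (λ e → ∣-resp (add′ (u * pw (a + + i)) (pw (a + + s + + i)) (+ t) b (+ j)) (∣m∣n⇒∣m+n e (near i))))
          where
          u = + (g ^ s %ℕ p)
          add : ∀ x x′ y t b j → (x - (b + j) - t) - (x - x′) ≡ x′ - (b + t + j)
          add = solve-∀
          add′ : ∀ x x′ t b j → (x′ - (b + t + j)) + (x - x′) ≡ x - (b + j) - t
          add′ = solve-∀
          swap : ∀ s a i → s + (a + i) ≡ a + s + i
          swap = solve-∀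
          near : ∀ i → u * pw (a + + i) ≡ pw (a + + s + + i) [mod p ]
          near i = mod-trans {a = u * pw (a + + i)} {g ^ s * pw (a + + i)}
            (mod-* {a = u} {g ^ s} {pw (a + + i)} (mod-sym {a = g ^ s} (residue-≡ (g ^ s))) (mod-refl (pw (a + + i))))
            (subst (λ z → g ^ s * pw (a + + i) ≡ pw z [mod p ]) (swap (+ s) a (+ i)) (pow-+ p-prime root s (a + + i)))

      -- Two periods in each direction, p - 1 for exponents and p for residues: this leaves room for
      -- the enlarged boxes, whose sides can be twice those of the given box.
      module _ (K≤ : K ℕ.≤ ℕ.pred p ℕ.+ ℕ.pred p) (N≤ : N ℕ.≤ p ℕ.+ p) where

        private
          coincidences≤ : coincidences p-prime points ℕ.≤ K ℕ.* N ℕ.* 4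
          coincidences≤ = begin
            ∑[ (x , y) ∈ points ] ∑[ (x′ , y′) ∈ points ] ⟦ (+ p ∣? x - x′) ×-dec (+ p ∣? y - y′) ⟧
              ≡⟨ trans (∑-cong points (λ (x , y) → trans (∑-points _) (∑-cong (upTo K) λ i′ → ∑-cong (upTo N) λ j′ →
                   ⟦×⟧ (+ p ∣? x - pw (a + + i′)) (+ p ∣? y - (b + + j′))))) (∑-points _) ⟩
            ∑[ i ∈ upTo K ] ∑[ j ∈ upTo N ] ∑[ i′ ∈ upTo K ] ∑[ j′ ∈ upTo N ] X i i′ ℕ.* Y j j′
              ≡⟨ ∑-cong (upTo K) (λ i → ∑-cong (upTo N) (λ j → ∑-*-∑ (upTo K) (X i) (upTo N) (Y j))) ⟨
            ∑[ i ∈ upTo K ] ∑[ j ∈ upTo N ] ∑ (upTo K) (X i) ℕ.* ∑ (upTo N) (Y j)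
              ≤⟨ ∑-mono (upTo K) (λ {i} _ → ∑-mono (upTo N) (λ {j} _ → ℕ.*-mono-≤ (X≤ i) (Y≤ j))) ⟩
            ∑[ i ∈ upTo K ] ∑[ j ∈ upTo N ] 4
              ≡⟨ trans (∑-cong (upTo K) (λ _ → trans (∑-const (upTo N) 4) (cong (ℕ._* 4) (length-upTo N))))
                   (trans (∑-const (upTo K) (N ℕ.* 4)) (trans (cong (ℕ._* (N ℕ.* 4)) (length-upTo K)) (sym (ℕ.*-assoc K N 4)))) ⟩
            K ℕ.* N ℕ.* 4 ∎
            where
            open ℕ.≤-Reasoning
            X Y : ℕ → ℕ → ℕ
            X i i′ = ⟦ + p ∣? pw (a + + i) - pw (a + + i′) ⟧
            Y j j′ = ⟦ + p ∣? (b + + j) - (b + + j′) ⟧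
            p-1+1 : ∀ m → suc (m ℕ.+ ℕ.pred p) ≡ m ℕ.+ p
            p-1+1 m = trans (sym (ℕ.+-suc m (ℕ.pred p))) (cong (m ℕ.+_) (ℕ.suc-pred p))
            X≤ : ∀ i → ∑ (upTo K) (X i) ℕ.≤ 2
            X≤ i = ∑-two-windows (λ i′ → + p ∣? pw (a + + i) - pw (a + + i′)) K≤ λ {m} {i′} {i″} m≤i′ i′≤i″ i″< e e′ →
              pow-injective p-prime root a i′≤i″
                (ℕ.<-≤-trans (subst (suc i″ ℕ.<_) (p-1+1 m) (ℕ.s≤s i″<)) (ℕ.+-monoˡ-≤ p m≤i′))
                (mod-trans {a = pw (a + + i′)} {pw (a + + i)} (mod-sym {a = pw (a + + i)} e) e′)
            diff : ∀ b j c d → (b + j - (b + d)) - (b + j - (b + c)) ≡ c - d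
            diff = solve-∀
            shift : ∀ m i j → i - j ≡ (m + i) - (m + j)
            shift = solve-∀
            Y≤ : ∀ j → ∑ (upTo N) (Y j) ℕ.≤ 2
            Y≤ j = ∑-two-windows (λ j′ → + p ∣? (b + + j) - (b + + j′)) N≤ λ {m} {j′} {j″} m≤j′ j′≤j″ j″< e e′ →
              offset m≤j′ (ℕ.≤-trans m≤j′ j′≤j″) (ℕ.≤-<-trans j′≤j″ j″<) j″<
                (∣-resp (diff b (+ j) (+ j′) (+ j″)) (∣m∣n⇒∣m-n e′ e))
              where
              offset : ∀ {m i j} → m ℕ.≤ i → m ℕ.≤ j → i ℕ.< m ℕ.+ p → j ℕ.< m ℕ.+ p → + i ≡ + j [mod p ] → i ≡ j
              offset {m} {i} {j} m≤i m≤j i< j< e = trans (sym (ℕ.m+[n∸m]≡n m≤i)) (trans (cong (m ℕ.+_)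
                (residue-unique (below m≤i i<) (below m≤j j<)
                  (∣-resp (sym (shift (+ m) (+ (i ∸ m)) (+ (j ∸ m))))
                    (subst₂ (λ x y → + x ≡ + y [mod p ]) (sym (ℕ.m+[n∸m]≡n m≤i)) (sym (ℕ.m+[n∸m]≡n m≤j)) e))))
                (ℕ.m+[n∸m]≡n m≤j))
                where
                below : ∀ {i} → m ℕ.≤ i → i ℕ.< m ℕ.+ p → i ∸ m ℕ.< p
                below {i} m≤i i< = ℕ.+-cancelˡ-< m _ _ (subst (ℕ._< m ℕ.+ p) (sym (ℕ.m+[n∸m]≡n m≤i)) i<)

        box-variance : ∀ {k n} → suc k ℕ.≤ p → n ℕ.≤ p →
          ∑[ s ∈ upTo k ] ∑[ t ∈ upTo n ]
            ∣ p ℕ.* box (a + + s) K (b + + t) N - K ℕ.* N ∣ ℕ.* ∣ p ℕ.* box (a + + s) K (b + + t) N - K ℕ.* N ∣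
          ℕ.≤ p ℕ.* p ℕ.* p ℕ.* (K ℕ.* N ℕ.* 4)
        box-variance {k} {n} k<p n≤p = begin
          ∑[ s ∈ upTo k ] ∑[ t ∈ upTo n ]
            ∣ p ℕ.* box (a + + s) K (b + + t) N - K ℕ.* N ∣ ℕ.* ∣ p ℕ.* box (a + + s) K (b + + t) N - K ℕ.* N ∣
            ≡⟨ ∑-cong (upTo k) (λ s → ∑-cong (upTo n) (λ t →
                 cong₂ (λ f L → ∣ p ℕ.* f - L ∣ ℕ.* ∣ p ℕ.* f - L ∣) (incidences-points s t) length-points)) ⟨
          ∑[ s ∈ upTo k ] ∑[ t ∈ upTo n ] D (g ^ s %ℕ p) t
            ≤⟨ ∑-mono (upTo k) (λ {s} _ → ∑-window {0} n≤p (D (g ^ s %ℕ p))) ⟩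
          ∑[ s ∈ upTo k ] ∑ (upTo p) (D (g ^ s %ℕ p))
            -- Slopes that are not among the first k powers of g only add non-negative terms.
            ≤⟨ ∑-injection ℕ._≟_ (λ s → g ^ s %ℕ p) (upTo⁺ k) (λ {s} _ → ∈-upTo⁺ (n%ℕd<d (g ^ s) p)) inj
                 (λ u → ∑ (upTo p) (D u)) ⟩
          ∑[ u ∈ upTo p ] ∑ (upTo p) (D u)
            ≤⟨ variance p-prime points ⟩
          p ℕ.* p ℕ.* p ℕ.* coincidences p-prime points
            ≤⟨ ℕ.*-monoʳ-≤ (p ℕ.* p ℕ.* p) coincidences≤ ⟩
          p ℕ.* p ℕ.* p ℕ.* (K ℕ.* N ℕ.* 4) ∎
          where
          open ℕ.≤-Reasoning
          D : ℕ → ℕ → ℕ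
          D u t = ∣ p ℕ.* incidences p-prime points u t - length points ∣ ℕ.* ∣ p ℕ.* incidences p-prime points u t - length points ∣
          congruent : ∀ {s s′} → g ^ s %ℕ p ≡ g ^ s′ %ℕ p → g ^ s ≡ g ^ s′ [mod p ]
          congruent {s} {s′} eq = mod-trans {a = g ^ s} {+ (g ^ s %ℕ p)} (residue-≡ (g ^ s))
            (subst (λ r → + r ≡ g ^ s′ [mod p ]) (sym eq) (mod-sym {a = g ^ s′} (residue-≡ (g ^ s′))))
          ordered : ∀ {s s′} → s ℕ.≤ s′ → s′ ℕ.< k → g ^ s %ℕ p ≡ g ^ s′ %ℕ p → s ≡ s′
          ordered {s} {s′} s≤s′ s′<k eq = pow-injective p-prime root (+ 0) s≤s′
            (ℕ.<-≤-trans (ℕ.≤-<-trans s′<k k<p) (ℕ.m≤n+m p s)) (congruent {s} {s′} eq)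
          inj : ∀ {s s′} → _ → _ → g ^ s %ℕ p ≡ g ^ s′ %ℕ p → s ≡ s′
          inj {s} {s′} s∈ s′∈ eq with ℕ.≤-total s s′
          ... | inj₁ s≤s′ = ordered s≤s′ (∈-upTo⁻ s′∈) eq
          ... | inj₂ s′≤s = sym (ordered s′≤s (∈-upTo⁻ s∈) (sym eq))

        module _ {k n : ℕ} (k<p : suc k ℕ.≤ p) (n≤p : n ℕ.≤ p) (d : ℕ)
                 (bound : ∀ {s t} → s ℕ.< k → t ℕ.< n → d ℕ.≤ ∣ p ℕ.* box (a + + s) K (b + + t) N - K ℕ.* N ∣) where

          -- A deviation of at least d shared by all k n translates is counted k n times by the
          -- variance. As d is a natural number, a truncated difference may be used for it, and an
          -- absent excess is then simply d = 0.
          uniform-deviation : k ℕ.* n ℕ.* (d ℕ.* d) ℕ.≤ p ℕ.* p ℕ.* p ℕ.* (K ℕ.* N ℕ.* 4)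
          uniform-deviation = begin
            k ℕ.* n ℕ.* (d ℕ.* d)
              ≡⟨ trans (∑-const (upTo k) (∑[ t ∈ upTo n ] d ℕ.* d)) (trans (cong₂ ℕ._*_ (length-upTo k)
                   (trans (∑-const (upTo n) (d ℕ.* d)) (cong (ℕ._* (d ℕ.* d)) (length-upTo n)))) (sym (ℕ.*-assoc k n (d ℕ.* d)))) ⟨
            ∑[ s ∈ upTo k ] ∑[ t ∈ upTo n ] d ℕ.* d
              ≤⟨ ∑-mono (upTo k) (λ s∈ → ∑-mono (upTo n) (λ t∈ → let d≤ = bound (∈-upTo⁻ s∈) (∈-upTo⁻ t∈) in ℕ.*-mono-≤ d≤ d≤)) ⟩
            _ ≤⟨ box-variance k<p n≤p ⟩
            p ℕ.* p ℕ.* p ℕ.* (K ℕ.* N ℕ.* 4) ∎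
            where open ℕ.≤-Reasoning

    module _ (a : ℤ) (K : ℕ) (b : ℤ) (N : ℕ) (K<p : suc K ℕ.≤ p) (N≤p : N ℕ.≤ p) {k n : ℕ} (k≤K : k ℕ.≤ K) (n≤N : n ℕ.≤ N) where

      private
        J = box a K b N

        K≤p-1 : K ℕ.≤ ℕ.pred p
        K≤p-1 = ℕ.suc[m]≤n⇒m≤pred[n] K<p

        k<p : suc k ℕ.≤ p
        k<p = ℕ.≤-trans (ℕ.s≤s k≤K) K<p

        n≤p : n ℕ.≤ p
        n≤p = ℕ.≤-trans n≤N N≤p

      -- The enlarged box starts at (a - k, b - n). Its translate by (s, t) contains the original
      -- box at offset (k - s, n - t), so all translates contain at least J solutions.
      box-upper : k ℕ.* n ℕ.* ((p ℕ.* J ∸ (K ℕ.+ k) ℕ.* (N ℕ.+ n)) ℕ.* (p ℕ.* J ∸ (K ℕ.+ k) ℕ.* (N ℕ.+ n)))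
                  ℕ.≤ p ℕ.* p ℕ.* p ℕ.* ((K ℕ.+ k) ℕ.* (N ℕ.+ n) ℕ.* 4)
      box-upper = uniform-deviation (a - + k) (K ℕ.+ k) (b - + n) (N ℕ.+ n)
        (ℕ.+-mono-≤ K≤p-1 (ℕ.≤-trans k≤K K≤p-1)) (ℕ.+-mono-≤ N≤p n≤p) k<p n≤p _ λ {s} {t} s<k t<n →
        ℕ.≤-trans (ℕ.∸-monoˡ-≤ ((K ℕ.+ k) ℕ.* (N ℕ.+ n)) (ℕ.*-monoʳ-≤ p
          (box-mono {a′ = a - + k + + s} {b′ = b - + n + + t} (k ∸ s) (n ∸ t)
            (shift a s<k) (fits K {k} {s}) (shift b t<n) (fits N {n} {t}))))
        (ℕ.m∸n≤∣m-n∣ _ ((K ℕ.+ k) ℕ.* (N ℕ.+ n)))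
        where
        cancel : ∀ a s r → a ≡ a - (s + r) + s + r
        cancel = solve-∀
        shift : ∀ a {s k} → s ℕ.< k → a ≡ a - + k + + s + + (k ∸ s)
        shift a {s} {k} s<k = trans (cancel a (+ s) (+ (k ∸ s)))
          (cong (λ z → a - + z + + s + + (k ∸ s)) (ℕ.m+[n∸m]≡n (ℕ.<⇒≤ s<k)))
        fits : ∀ K {k s} → k ∸ s ℕ.+ K ℕ.≤ K ℕ.+ k
        fits K {k} {s} = ℕ.≤-trans (ℕ.≤-reflexive (ℕ.+-comm (k ∸ s) K)) (ℕ.+-monoʳ-≤ K (ℕ.m∸n≤m k s))

      -- The shrunken box keeps the corner (a, b), and shifts below k and n do not leave the
      -- original box. For k = K or n = N it is empty and the deviation is 0; this happens at the
      -- scale t = 1.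
      box-lower : k ℕ.* n ℕ.* (((K ∸ k) ℕ.* (N ∸ n) ∸ p ℕ.* J) ℕ.* ((K ∸ k) ℕ.* (N ∸ n) ∸ p ℕ.* J))
                  ℕ.≤ p ℕ.* p ℕ.* p ℕ.* ((K ∸ k) ℕ.* (N ∸ n) ℕ.* 4)
      box-lower = uniform-deviation a (K ∸ k) b (N ∸ n)
        (ℕ.≤-trans (ℕ.m∸n≤m K k) (ℕ.≤-trans K≤p-1 (ℕ.m≤m+n _ _)))
        (ℕ.≤-trans (ℕ.m∸n≤m N n) (ℕ.≤-trans N≤p (ℕ.m≤m+n _ _))) k<p n≤p _ λ {s} {t} s<k t<n →
        ℕ.≤-trans (ℕ.∸-monoʳ-≤ ((K ∸ k) ℕ.* (N ∸ n)) (ℕ.*-monoʳ-≤ p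
          (box-mono {a′ = a} {b′ = b} s t refl (fits k≤K s<k) refl (fits n≤N t<n))))
        (ℕ.≤-trans (ℕ.m∸n≤∣m-n∣ ((K ∸ k) ℕ.* (N ∸ n)) _) (ℕ.≤-reflexive (ℕ.∣-∣-comm ((K ∸ k) ℕ.* (N ∸ n)) (p ℕ.* box (a + + s) (K ∸ k) (b + + t) (N ∸ n)))))
        where
        fits : ∀ {K k s} → k ℕ.≤ K → s ℕ.< k → s ℕ.+ (K ∸ k) ℕ.≤ K
        fits {K} {k} k≤K s<k = ℕ.≤-trans (ℕ.+-monoˡ-≤ (K ∸ k) (ℕ.<⇒≤ s<k)) (ℕ.≤-reflexive (ℕ.m+[n∸m]≡n k≤K))

-- From the filtered list of exponents to a box count.

module Counting where

  open Sums
  open Incidences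
  open Powers
  open Boxes
  open import Data.Nat.Base as ℕ using (ℕ; suc)
  import Data.Nat.Properties as ℕ
  open import Data.Nat.Primality using (Prime)
  open import Data.Integer.Base using (ℤ; +_; 0ℤ; 1ℤ; ∣_∣; _+_; _-_; -_; _⊔_; +≤+) renaming (_≤_ to _≤ᶻ_)
  import Data.Integer.Properties as ℤ
  open import Data.Integer.Divisibility.Signed using (_∣?_; ∣m∣n⇒∣m-n)
  open import Data.Integer.Tactic.RingSolver using (solve-∀)
  open import Data.List.Base using (upTo; length)
  open import Data.List.Membership.Propositional.Properties using (∈-upTo⁺; ∈-upTo⁻)
  open import Data.List.Relation.Unary.Unique.Propositional.Properties using (upTo⁺)
  open import Data.Product.Base using (_,_)
  open import Relation.Nullary.Decidable using (yes; no)
  open import Relation.Binary.PropositionalEquality hiding (J)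

  -- Existence equals multiplicity here: at most p consecutive integers are pairwise incongruent, so
  -- a residue has at most one representative among them.
  congruentInto-count : ∀ {p} z b N → N ℕ.≤ p →
    ⟦ congruentInto? p z (b + 1ℤ) (b + + N) ⟧ ≡ ∑[ j ∈ upTo N ] ⟦ + p ∣? z - (b + 1ℤ + + j) ⟧
  congruentInto-count {p} z b N N≤p with congruentInto? p z (b + 1ℤ) (b + + N)
  ... | yes (y , b<y , y≤b+N , z≡y) = ℕ.≤-antisym
    (ℕ.≤-trans (⟦⟧-true (+ p ∣? z - (b + 1ℤ + + j)) (subst (λ y → z ≡ y [mod p ]) y≡ z≡y))
               (∑-term (λ j → ⟦ + p ∣? z - (b + 1ℤ + + j) ⟧) (∈-upTo⁺ j<N)))
    (∑-at-most-one (λ j → + p ∣? z - (b + 1ℤ + + j)) (upTo⁺ N) λ {i} {i′} i∈ i′∈ e e′ →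
      residue-unique (ℕ.<-≤-trans (∈-upTo⁻ i∈) N≤p) (ℕ.<-≤-trans (∈-upTo⁻ i′∈) N≤p)
        (∣-resp (sub z b (+ i) (+ i′)) (∣m∣n⇒∣m-n e′ e)))
    where
    j = ∣ y - (b + 1ℤ) ∣
    +j≡ : + j ≡ y - (b + 1ℤ)
    +j≡ = ℤ.0≤i⇒+∣i∣≡i (ℤ.i≤j⇒0≤j-i b<y)
    add-sub : ∀ y b → y ≡ b + (y - b)
    add-sub = solve-∀
    y≡ : y ≡ b + 1ℤ + + j
    y≡ = trans (add-sub y (b + 1ℤ)) (cong (λ z → b + 1ℤ + z) (sym +j≡))
    assoc : ∀ b j → b + 1ℤ + j ≡ b + (1ℤ + j)
    assoc = solve-∀
    j<N : j ℕ.< N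
    j<N = ℤ.drop‿+≤+ (subst₂ _≤ᶻ_ (cancel b (+ suc j)) (cancel b (+ N))
      (ℤ.+-monoʳ-≤ (- b) (subst (_≤ᶻ b + + N) (trans y≡ (assoc b (+ j))) y≤b+N)))
      where
      cancel : ∀ b x → - b + (b + x) ≡ x
      cancel = solve-∀
    sub : ∀ z b i i′ → z - (b + 1ℤ + i′) - (z - (b + 1ℤ + i)) ≡ i - i′
    sub = solve-∀
  ... | no ¬into = sym (ℕ.n≤0⇒n≡0 (ℕ.≤-trans
    (∑-mono (upTo N) λ {j} j∈ → ℕ.≤-reflexive (⟦⟧-false (+ p ∣? z - (b + 1ℤ + + j)) λ e →
      ¬into (b + 1ℤ + + j , ℤ.i≤i+j (b + 1ℤ) (+ j) ,
        subst (_≤ᶻ b + + N) (sym (assoc b (+ j))) (ℤ.+-monoʳ-≤ b (+≤+ (∈-upTo⁻ j∈))) , e)))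
    (ℕ.≤-reflexive (trans (∑-const (upTo N) 0) (ℕ.*-zeroʳ (length (upTo N)))))))
    where
    assoc : ∀ b j → b + 1ℤ + j ≡ b + (1ℤ + j)
    assoc = solve-∀

  powersInInterval≡box : ∀ {p} (p-prime : Prime p) {g} (root : PrimitiveRoot p g) H K M N → N ℕ.≤ p →
    powersInInterval p g root H (+ K) M (+ N) ≡ box p-prime root (H + 1ℤ) K (M + 1ℤ) N
  powersInInterval≡box {p} p-prime root H K M N N≤p = begin
    powersInInterval p _ root H (+ K) M (+ N)
      ≡⟨ length-filter (λ x → congruentInto? p (pow p-prime root x) (M + 1ℤ) (M + + N)) (interval (H + 1ℤ) (H + + K)) ⟩
    ∑[ x ∈ interval (H + 1ℤ) (H + + K) ] ⟦ congruentInto? p (pow p-prime root x) (M + 1ℤ) (M + + N) ⟧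
      ≡⟨ ∑-cong (interval (H + 1ℤ) (H + + K)) (λ x → congruentInto-count (pow p-prime root x) M N N≤p) ⟩
    ∑[ x ∈ interval (H + 1ℤ) (H + + K) ] ∑[ j ∈ upTo N ] ⟦ + p ∣? pow p-prime root x - (M + 1ℤ + + j) ⟧
      ≡⟨ ∑-map (λ i → H + 1ℤ + + i) (upTo ∣ (1ℤ + (H + + K) - (H + 1ℤ)) ⊔ 0ℤ ∣) _ ⟩
    ∑[ i ∈ upTo ∣ (1ℤ + (H + + K) - (H + 1ℤ)) ⊔ 0ℤ ∣ ] row i
      ≡⟨ cong (λ n → ∑ (upTo n) row) (trans (cong (λ z → ∣ z ⊔ 0ℤ ∣) (size H (+ K))) (cong ∣_∣ (ℤ.i≥j⇒i⊔j≡i {+ K} {0ℤ} (+≤+ ℕ.z≤n)))) ⟩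
    box p-prime root (H + 1ℤ) K (M + 1ℤ) N ∎
    where
    open ≡-Reasoning
    row : ℕ → ℕ
    row i = ∑[ j ∈ upTo N ] ⟦ + p ∣? pow p-prime root (H + 1ℤ + + i) - (M + 1ℤ + + j) ⟧
    size : ∀ h k → 1ℤ + (h + k) - (h + 1ℤ) ≡ k
    size = solve-∀

-- Integer square roots and the choice of scale.

module Scales where

  open import Data.Nat.Base
  open import Data.Nat.Properties
  open import Data.Nat.DivMod using (_/_; m/n*n≤m; m%n<n; m≡m%n+[m/n]*n; m≥n⇒m/n>0)
  open import Data.Nat.Tactic.RingSolver using (solve-∀)
  open import Data.Product.Base using (∃; _×_; _,_)
  open import Data.Sum.Base using (_⊎_; inj₁; inj₂)
  open import Relation.Nullary.Decidable using (yes; no)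
  open import Relation.Binary.PropositionalEquality using (_≡_; refl; sym; cong; cong₂; subst)

  sq : ℕ → ℕ
  sq n = n * n

  sq-mono : ∀ {m n} → m ≤ n → sq m ≤ sq n
  sq-mono m≤n = *-mono-≤ m≤n m≤n

  sq-cancel : ∀ {m n} → sq m ≤ sq n → m ≤ n
  sq-cancel {m} {n} m²≤n² = ≮⇒≥ λ n<m → <⇒≱ (*-mono-< n<m n<m) m²≤n²

  isqrt : ∀ n → ∃ λ r → sq r ≤ n × n < sq (suc r)
  isqrt zero    = 0 , z≤n , s≤s z≤n
  isqrt (suc n) with isqrt n
  ... | r , r²≤n , n<[r+1]² with suc n <? sq (suc r)
  ...   | yes n+1<[r+1]² = r , m≤n⇒m≤1+n r²≤n , n+1<[r+1]²
  ...   | no  n+1≮[r+1]² = suc r , ≮⇒≥ n+1≮[r+1]² , ≤-<-trans n<[r+1]² (*-mono-< (n<1+n (suc r)) (n<1+n (suc r)))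

  suc≤2* : ∀ {r} → 1 ≤ r → suc r ≤ 2 * r
  suc≤2* {r} 1≤r = ≤-trans (+-monoˡ-≤ r 1≤r) (≤-reflexive (cong (r +_) (sym (+-identityʳ r))))

  sq-suc : ∀ {r} → 1 ≤ r → sq (suc r) ≤ 4 * sq r
  sq-suc {r} 1≤r = ≤-trans (sq-mono (suc≤2* 1≤r)) (≤-reflexive (expand r))
    where
    expand : ∀ r → 2 * r * (2 * r) ≡ 4 * (r * r)
    expand = solve-∀

  -- For n ≥ 1 rounding up also stays within a factor 2 of the root, so r and `suc r` are available
  -- as lower and upper approximations.
  isqrt⁺ : ∀ n → 1 ≤ n → ∃ λ r → 1 ≤ r × sq r ≤ n × n < sq (suc r) × sq (suc r) ≤ 4 * n
  isqrt⁺ n 1≤n with isqrt n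
  ... | zero  , _    , n<1      with () ← <⇒≱ n<1 1≤n
  ... | suc r , r²≤n , n<[r+1]² = suc r , s≤s z≤n , r²≤n , n<[r+1]² , ≤-trans (sq-suc (s≤s z≤n)) (*-monoʳ-≤ 4 r²≤n)

  module _ {p K N k n t w pJ : ℕ}
    (1≤k : 1 ≤ k) (1≤n : 1 ≤ n) (1≤t : 1 ≤ t)
    (kt≤K : k * t ≤ K) (K≤2kt : K ≤ 2 * (k * t)) (nt≤N : n * t ≤ N) (N≤2nt : N ≤ 2 * (n * t))
    (KN≤4t²w : K * N ≤ 4 * sq t * w) (p³≤w² : p * p * p ≤ sq w) where

    private
      instance
        kn≢0 : NonZero (k * n)
        kn≢0 = >-nonZero (*-mono-≤ 1≤k 1≤n)
        t≢0 : NonZero t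
        t≢0 = >-nonZero 1≤t

      KN≤4knt² : K * N ≤ 4 * (k * n) * sq t
      KN≤4knt² = ≤-trans (*-mono-≤ K≤2kt N≤2nt) (≤-reflexive (rearrange k n t))
        where
        rearrange : ∀ k n t → 2 * (k * t) * (2 * (n * t)) ≡ 4 * (k * n) * (t * t)
        rearrange = solve-∀

      k≤K : k ≤ K
      k≤K = ≤-trans (m≤m*n k t) kt≤K
      n≤N : n ≤ N
      n≤N = ≤-trans (m≤m*n n t) nt≤N

      -- Applied to the area changes K n, k N and k n: one factor t turns each into at most K N ≤ 4
      -- t² w, and cancelling it leaves 4 t w.
      cancel-t : ∀ {x} → x * t ≤ K * N → x ≤ 4 * (t * w)
      cancel-t {x} xt≤KN = *-cancelʳ-≤ x (4 * (t * w)) t (≤-trans xt≤KN (≤-trans KN≤4t²w (≤-reflexive (rearrange t w))))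
        where
        rearrange : ∀ t w → 4 * (t * t) * w ≡ 4 * (t * w) * t
        rearrange = solve-∀

      Kn≤4tw : K * n ≤ 4 * (t * w)
      Kn≤4tw = cancel-t (≤-trans (≤-reflexive (*-assoc K n t)) (*-monoʳ-≤ K nt≤N))
      kN≤4tw : k * N ≤ 4 * (t * w)
      kN≤4tw = cancel-t (≤-trans (≤-reflexive (rearrange k N t)) (*-monoˡ-≤ N kt≤K))
        where
        rearrange : ∀ k N t → k * N * t ≡ k * t * N
        rearrange = solve-∀
      kn≤4tw : k * n ≤ 4 * (t * w)
      kn≤4tw = ≤-trans (*-monoˡ-≤ n k≤K) Kn≤4tw

      -- Solves the variance inequality for d. With L ≤ c² K N ≤ 4 c² k n t² and p³ ≤ w² the right
      -- side is at most k n (4 c t w)², so k n cancels and a square root can be taken.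
      root-bound : ∀ {d L} c → k * n * sq d ≤ p * p * p * (L * 4) → L ≤ sq c * (K * N) → d ≤ 4 * c * (t * w)
      root-bound {d} {L} c h L≤ = sq-cancel (*-cancelˡ-≤ (k * n) (begin
        k * n * sq d                                ≤⟨ h ⟩
        p * p * p * (L * 4)                         ≤⟨ *-mono-≤ p³≤w² (*-monoˡ-≤ 4 (≤-trans L≤ (*-monoʳ-≤ (sq c) KN≤4knt²))) ⟩
        sq w * (sq c * (4 * (k * n) * sq t) * 4)    ≡⟨ rearrange c (k * n) t w ⟩
        k * n * sq (4 * c * (t * w))                ∎))
        where
        open ≤-Reasoning
        rearrange : ∀ c m t w → w * w * (c * c * (4 * m * (t * t)) * 4) ≡ m * (4 * c * (t * w) * (4 * c * (t * w)))
        rearrange = solve-∀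

    -- The enlarged area is at most 4 K N, so c = 2 and the variance contributes 8 t w; the three
    -- strips K n, k N, k n contribute 4 t w each, which makes 20.
    upper-deviation : k * n * sq (pJ ∸ (K + k) * (N + n)) ≤ p * p * p * ((K + k) * (N + n) * 4) →
                      pJ ≤ K * N + 20 * (t * w)
    upper-deviation h = begin
      pJ                                          ≤⟨ m≤n+m∸n pJ L ⟩
      L + (pJ ∸ L)                                ≤⟨ +-monoʳ-≤ L (root-bound {L = L} 2 h L≤4KN) ⟩
      L + 8 * (t * w)                             ≡⟨ cong (_+ 8 * (t * w)) (expand K k N n) ⟩
      K * N + (K * n + k * N + k * n) + 8 * (t * w)
        ≤⟨ +-monoˡ-≤ (8 * (t * w)) (+-monoʳ-≤ (K * N) (+-mono-≤ (+-mono-≤ Kn≤4tw kN≤4tw) kn≤4tw)) ⟩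
      K * N + (4 * (t * w) + 4 * (t * w) + 4 * (t * w)) + 8 * (t * w) ≡⟨ collect (K * N) (t * w) ⟩
      K * N + 20 * (t * w)                        ∎
      where
      open ≤-Reasoning
      L = (K + k) * (N + n)
      expand : ∀ K k N n → (K + k) * (N + n) ≡ K * N + (K * n + k * N + k * n)
      expand = solve-∀
      collect : ∀ a x → a + (4 * x + 4 * x + 4 * x) + 8 * x ≡ a + 20 * x
      collect = solve-∀
      double : ∀ K N → (K + K) * (N + N) ≡ 4 * (K * N)
      double = solve-∀
      L≤4KN : L ≤ 4 * (K * N)
      L≤4KN = ≤-trans (*-mono-≤ (+-monoʳ-≤ K k≤K) (+-monoʳ-≤ N n≤N)) (≤-reflexive (double K N))

    -- Here c = 1, so the variance and the two strips cost 4 t w each. The total 12 is raised to 20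
    -- to share one error term with the upper bound.
    lower-deviation : k * n * sq ((K ∸ k) * (N ∸ n) ∸ pJ) ≤ p * p * p * ((K ∸ k) * (N ∸ n) * 4) →
                      K * N ≤ pJ + 20 * (t * w)
    lower-deviation h = begin
      K * N                                       ≡⟨ cong₂ _*_ (m∸n+n≡m k≤K) (m∸n+n≡m n≤N) ⟨
      (K ∸ k + k) * (N ∸ n + n)                   ≡⟨ expand (K ∸ k) k (N ∸ n) n ⟩
      L + (K ∸ k + k) * n + k * (N ∸ n)           ≤⟨ +-mono-≤ (+-mono-≤ L≤ (≤-trans (≤-reflexive (cong (_* n) (m∸n+n≡m k≤K))) Kn≤4tw))
                                                       (≤-trans (*-monoʳ-≤ k (m∸n≤m N n)) kN≤4tw) ⟩
      pJ + 4 * (t * w) + 4 * (t * w) + 4 * (t * w) ≡⟨ collect pJ (t * w) ⟩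
      pJ + 12 * (t * w)                           ≤⟨ +-monoʳ-≤ pJ (*-monoˡ-≤ (t * w) (m≤m+n 12 8)) ⟩
      pJ + 20 * (t * w)                           ∎
      where
      open ≤-Reasoning
      L = (K ∸ k) * (N ∸ n)
      expand : ∀ K k N n → (K + k) * (N + n) ≡ K * N + (K + k) * n + k * N
      expand = solve-∀
      collect : ∀ a x → a + 4 * x + 4 * x + 4 * x ≡ a + 12 * x
      collect = solve-∀
      L≤ : L ≤ pJ + 4 * (t * w)
      L≤ = ≤-trans (m≤n+m∸n L pJ) (+-monoʳ-≤ pJ (root-bound {L = L} 1 h
        (≤-trans (*-mono-≤ (m∸n≤m K k) (m∸n≤m N n)) (≤-reflexive (sym (*-identityˡ (K * N)))))))

  m<[1+m/n]*n : ∀ m n .{{_ : NonZero n}} → m < suc (m / n) * n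
  m<[1+m/n]*n m n = subst (_< suc (m / n) * n) (sym (m≡m%n+[m/n]*n m n)) (+-monoˡ-< (m / n * n) (m%n<n m n))

  -- Here w approximates p^(3/2) from above, and k and n approximate K / t and N / t from below
  -- within a factor 2. `KN≤4t²w` says that t is large enough for the strips; `t-small` says that it
  -- is no larger than the final estimate allows.
  record Scale (p K N : ℕ) : Set where
    field
      k n t w  : ℕ
      1≤k      : 1 ≤ k
      1≤n      : 1 ≤ n
      1≤t      : 1 ≤ t
      kt≤K     : k * t ≤ K
      K≤2kt    : K ≤ 2 * (k * t)
      nt≤N     : n * t ≤ N
      N≤2nt    : N ≤ 2 * (n * t)
      KN≤4t²w  : K * N ≤ 4 * sq t * w
      p³≤w²    : p * p * p ≤ sq w
      w²≤4p³   : sq w ≤ 4 * (p * p * p)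
      t-small  : t ≡ 1 ⊎ sq t * w ≤ K * N

  -- With w ≈ p^(3/2), t is about (K N / w)^(1/2) and the shift ranges are about K / t and N / t.
  scale : ∀ {p K N} → 1 ≤ K → K < p → 1 ≤ N → N < p → Scale p K N
  scale {p} {K} {N} 1≤K K<p 1≤N N<p with isqrt⁺ (p * p * p) (*-mono-≤ (*-mono-≤ 1≤p 1≤p) 1≤p)
    where
    1≤p = <⇒≤ (≤-<-trans 1≤K K<p)
  ... | r , 1≤r , r²≤p³ , p³<w² , w²≤4p³ with K * N <? suc r
  ...   | yes KN<w = record
    -- The area is below w: the shift ranges are the full sides, and the lower estimate amounts to K
    -- N being itself within the error.
    { k = K ; n = N ; t = 1 ; w = suc r ; 1≤k = 1≤K ; 1≤n = 1≤N ; 1≤t = ≤-refl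
    ; kt≤K = ≤-reflexive (*-identityʳ K) ; K≤2kt = twice K ; nt≤N = ≤-reflexive (*-identityʳ N) ; N≤2nt = twice N
    ; KN≤4t²w = ≤-trans (<⇒≤ KN<w) (m≤n*m (suc r) 4)
    ; p³≤w² = <⇒≤ p³<w² ; w²≤4p³ = w²≤4p³ ; t-small = inj₁ refl }
    where
    twice : ∀ K → K ≤ 2 * (K * 1)
    twice K = ≤-trans (≤-reflexive (sym (*-identityʳ K))) (m≤n*m (K * 1) 2)
  ...   | no KN≮w with isqrt⁺ (K * N / suc r) (m≥n⇒m/n>0 {K * N} {suc r} (≮⇒≥ KN≮w))
  ...     | suc t′ , 1≤t , t²≤q , q<[t+1]² , _ = record
    { k = K / t ; n = N / t ; t = t ; w = w
    ; 1≤k = m≥n⇒m/n>0 {K} {t} t≤K ; 1≤n = m≥n⇒m/n>0 {N} {t} t≤N ; 1≤t = 1≤t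
    ; kt≤K = m/n*n≤m K t ; K≤2kt = halves K t≤K ; nt≤N = m/n*n≤m N t ; N≤2nt = halves N t≤N
    ; KN≤4t²w = ≤-trans (<⇒≤ (m<[1+m/n]*n (K * N) w))
        (*-monoˡ-≤ w (≤-trans q<[t+1]² (sq-suc 1≤t)))
    ; p³≤w² = <⇒≤ p³<w² ; w²≤4p³ = w²≤4p³ ; t-small = inj₂ t²w≤KN }
    where
    t = suc t′
    w = suc r
    t²w≤KN : sq t * w ≤ K * N
    t²w≤KN = ≤-trans (*-monoˡ-≤ w t²≤q) (m/n*n≤m (K * N) w)
    p≤w : p ≤ w
    p≤w = sq-cancel (≤-trans (m≤m*n (p * p) p {{>-nonZero (≤-<-trans z≤n K<p)}}) (<⇒≤ p³<w²))
    -- From t² w ≤ A B and B < p ≤ w it follows that t² ≤ A, so t fits into either side and the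
    -- quotients K / t and N / t are positive.
    t≤ : ∀ {A B} → B < p → sq t * w ≤ A * B → t ≤ A
    t≤ {A} {B} B<p t²w≤AB = ≤-trans (m≤m*n t t) (*-cancelʳ-≤ (sq t) A w (≤-trans t²w≤AB (*-monoʳ-≤ A (≤-trans (<⇒≤ B<p) p≤w))))
    t≤K : t ≤ K
    t≤K = t≤ N<p t²w≤KN
    t≤N : t ≤ N
    t≤N = t≤ K<p (subst (sq t * w ≤_) (*-comm K N) t²w≤KN)
    halves : ∀ K → t ≤ K → K ≤ 2 * (K / t * t)
    halves K t≤K = ≤-trans (<⇒≤ (m<[1+m/n]*n K t)) (≤-trans (*-monoˡ-≤ t (suc≤2* (m≥n⇒m/n>0 {K} {t} t≤K))) (≤-reflexive (*-assoc 2 (K / t) t)))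

  -- The integer form of t w p^(1/4) ≪ (K N)^(1/2) p, proved by comparing fourth powers: (t w d)⁴ =
  -- (t² w)² w² d⁴. The constants multiply to 256 · 4 · 64 = 16⁴.
  fourth-root-bound : ∀ {p K N t w b d k n} → K ≤ 4 * sq k → N ≤ 4 * sq n → sq b ≤ 4 * p → sq d ≤ 4 * b →
                      sq w ≤ 4 * (p * p * p) → sq t * w ≤ K * N → t * w * d ≤ 16 * (k * n * p)
  fourth-root-bound {p} {K} {N} {t} {w} {b} {d} {k} {n} K≤ N≤ b²≤ d²≤ w²≤ t²w≤ = sq-cancel (sq-cancel (begin
    sq (sq (t * w * d))                             ≡⟨ split t w d ⟩
    sq (sq t * w) * sq w * sq (sq d)                ≤⟨ *-mono-≤ (*-mono-≤ (sq-mono (≤-trans t²w≤ (*-mono-≤ K≤ N≤))) w²≤) (sq-mono d²≤) ⟩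
    sq (4 * sq k * (4 * sq n)) * (4 * (p * p * p)) * sq (4 * b)   ≡⟨ cong (sq (4 * sq k * (4 * sq n)) * (4 * (p * p * p)) *_) (sixteen b) ⟩
    sq (4 * sq k * (4 * sq n)) * (4 * (p * p * p)) * (16 * sq b)  ≤⟨ *-monoʳ-≤ (sq (4 * sq k * (4 * sq n)) * (4 * (p * p * p))) (*-monoʳ-≤ 16 b²≤) ⟩
    sq (4 * sq k * (4 * sq n)) * (4 * (p * p * p)) * (16 * (4 * p)) ≡⟨ collect k n p ⟩
    sq (sq (16 * (k * n * p)))                      ∎))
    where
    open ≤-Reasoning
    split : ∀ t w d → t * w * d * (t * w * d) * (t * w * d * (t * w * d)) ≡ t * t * w * (t * t * w) * (w * w) * (d * d * (d * d))
    split = solve-∀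
    sixteen : ∀ b → 4 * b * (4 * b) ≡ 16 * (b * b)
    sixteen = solve-∀
    collect : ∀ k n p → 4 * (k * k) * (4 * (n * n)) * (4 * (k * k) * (4 * (n * n))) * (4 * (p * p * p)) * (16 * (4 * p)) ≡
                        16 * (k * n * p) * (16 * (k * n * p)) * (16 * (k * n * p) * (16 * (k * n * p)))
    collect = solve-∀

  -- `κ` and `ν` round the roots of K and N down, since they stand in a numerator to be bounded
  -- below; `b` and `d` round p^(1/2) and p^(1/4) up, since p^(1/4) stands in a denominator.
  record Roots (p K N : ℕ) : Set where
    field
      κ ν b d    : ℕ
      1≤κ        : 1 ≤ κ
      1≤ν        : 1 ≤ ν
      1≤b        : 1 ≤ b
      1≤d        : 1 ≤ d
      κ²≤K       : sq κ ≤ K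
      K≤4κ²      : K ≤ 4 * sq κ
      ν²≤N       : sq ν ≤ N
      N≤4ν²      : N ≤ 4 * sq ν
      p<b²       : p < sq b
      b²≤4p      : sq b ≤ 4 * p
      b<d²       : b < sq d
      d²≤4b      : sq d ≤ 4 * b

  roots : ∀ {p K N} → 1 ≤ p → 1 ≤ K → 1 ≤ N → Roots p K N
  roots {p} {K} {N} 1≤p 1≤K 1≤N with isqrt⁺ K 1≤K | isqrt⁺ N 1≤N | isqrt⁺ p 1≤p
  ... | κ , 1≤κ , κ²≤K , K<[κ+1]² , _ | ν , 1≤ν , ν²≤N , N<[ν+1]² , _ | b , _ , _ , p<b² , b²≤4p with isqrt⁺ (suc b) (s≤s z≤n)
  ...   | d , _ , _ , b<d² , d²≤4b = record
    { κ = κ ; ν = ν ; b = suc b ; d = suc d ; 1≤κ = 1≤κ ; 1≤ν = 1≤ν ; 1≤b = s≤s z≤n ; 1≤d = s≤s z≤n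
    ; κ²≤K = κ²≤K ; K≤4κ² = ≤-trans (<⇒≤ K<[κ+1]²) (sq-suc 1≤κ)
    ; ν²≤N = ν²≤N ; N≤4ν² = ≤-trans (<⇒≤ N<[ν+1]²) (sq-suc 1≤ν)
    ; p<b² = p<b² ; b²≤4p = b²≤4p ; b<d² = b<d² ; d²≤4b = d²≤4b }

  module _ {c p K N : ℕ} (3840≤c : 3840 ≤ c) (S : Scale p K N) where

    open Scale S

    -- The cross-multiplied form of 20 t w / p ≤ c · w / (4 p), where w / (4 p) is the fraction used
    -- below √p.
    small-scale : t ≡ 1 → 20 * (t * w) * (1 * (4 * p)) ≤ c * w * p
    small-scale t≡1 = begin
      20 * (t * w) * (1 * (4 * p))  ≡⟨ cong (λ t → 20 * (t * w) * (1 * (4 * p))) t≡1 ⟩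
      20 * (1 * w) * (1 * (4 * p))  ≡⟨ rearrange p w ⟩
      w * p * 80                    ≤⟨ *-monoʳ-≤ (w * p) (≤-trans (m≤m+n 80 3760) 3840≤c) ⟩
      w * p * c                     ≡⟨ commute w p c ⟩
      c * w * p                     ∎
      where
      open ≤-Reasoning
      rearrange : ∀ p w → 20 * (1 * w) * (1 * (4 * p)) ≡ w * p * 80
      rearrange = solve-∀
      commute : ∀ w p c → w * p * c ≡ c * w * p
      commute = solve-∀

    -- The cross-multiplied form of 20 t w / p ≤ c · κ ν / (12 d). The constant is 3840 = 20 · 12 ·
    -- 16: error term, denominators 2 · 2 · 3 of the rational approximations, and
    -- `fourth-root-bound`.
    large-scale : (R : Roots p K N) → (let open Roots R) → sq t * w ≤ K * N →
                  20 * (t * w) * (1 * (2 * 2 * (3 * d))) ≤ c * (κ * ν * 1) * p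
    large-scale R t²w≤KN = begin
      20 * (t * w) * (1 * (2 * 2 * (3 * d)))  ≡⟨ rearrange t w d ⟩
      t * w * d * 240                         ≤⟨ *-monoˡ-≤ 240 (fourth-root-bound {p} {K} {N} {t} {w} {b} {d} {κ} {ν}
                                                   K≤4κ² N≤4ν² b²≤4p d²≤4b w²≤4p³ t²w≤KN) ⟩
      16 * (κ * ν * p) * 240                  ≡⟨ cong (_* 240) (*-comm 16 (κ * ν * p)) ⟩
      κ * ν * p * 16 * 240                    ≡⟨ *-assoc (κ * ν * p) 16 240 ⟩
      κ * ν * p * 3840                        ≤⟨ *-monoʳ-≤ (κ * ν * p) 3840≤c ⟩
      κ * ν * p * c                           ≡⟨ reorder c κ ν p ⟩
      c * (κ * ν * 1) * p                     ∎
      where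
      open Roots R
      open ≤-Reasoning
      rearrange : ∀ t w d → 20 * (t * w) * (1 * (2 * 2 * (3 * d))) ≡ t * w * d * 240
      rearrange = solve-∀
      reorder : ∀ c k n p → k * n * p * c ≡ c * (k * n * 1) * p
      reorder = solve-∀

-- The deviation estimate over the natural numbers.

module Deviation where

  open Boxes
  open Counting
  open Scales
  open import Data.Nat.Base
  open import Data.Nat.Properties
  open import Data.Nat.Primality using (Prime)
  open import Data.Integer.Base using (+_; 1ℤ) renaming (_+_ to _+ᶻ_)
  open import Data.Product.Base using (_×_; _,_)
  open import Relation.Binary.PropositionalEquality hiding (J)

  powersInInterval-deviation : ∀ {p} (p-prime : Prime p) {g} (root : PrimitiveRoot p g) H K M N (S : Scale p K N) →
    K < p → N < p → (let open Scale S using (t; w)) →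
    p * powersInInterval p g root H (+ K) M (+ N) ≤ K * N + 20 * (t * w) ×
    K * N ≤ p * powersInInterval p g root H (+ K) M (+ N) + 20 * (t * w)
  powersInInterval-deviation {p} p-prime {g} root H K M N S K<p N<p =
    subst (λ J → p * J ≤ K * N + 20 * (t * w) × K * N ≤ p * J + 20 * (t * w))
      (sym (powersInInterval≡box p-prime root H K M N (<⇒≤ N<p)))
      ( upper-deviation {p} {pJ = p * J} 1≤k 1≤n 1≤t kt≤K K≤2kt nt≤N N≤2nt KN≤4t²w p³≤w²
          (box-upper p-prime root (H +ᶻ 1ℤ) K (M +ᶻ 1ℤ) N K<p (<⇒≤ N<p) k≤K n≤N)
      , lower-deviation {p} {pJ = p * J} 1≤k 1≤n 1≤t kt≤K K≤2kt nt≤N N≤2nt KN≤4t²w p³≤w²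
          (box-lower p-prime root (H +ᶻ 1ℤ) K (M +ᶻ 1ℤ) N K<p (<⇒≤ N<p) k≤K n≤N))
    where
    open Scale S
    J = box p-prime root (H +ᶻ 1ℤ) K (M +ᶻ 1ℤ) N
    k≤K : k ≤ K
    k≤K = ≤-trans (m≤m*n k t {{>-nonZero 1≤t}}) kt≤K
    n≤N : n ≤ N
    n≤N = ≤-trans (m≤m*n n t {{>-nonZero 1≤t}}) nt≤N

-- Fractions of natural numbers, compared by cross-multiplication.

module Fractions where

  open import Data.Nat.Base as ℕ using (ℕ; suc; NonZero)
  import Data.Nat.Properties as ℕ
  open import Data.Integer.Base as ℤ using (+_)
  import Data.Integer.Properties as ℤ
  open import Data.Integer.Tactic.RingSolver using (solve-∀)
  open import Data.Rational.Unnormalised.Base as ℚᵘ using (mkℚᵘ; *≡*; *<*)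
  import Data.Rational.Unnormalised.Properties as ℚᵘ
  open import Data.Rational.Base hiding (NonZero)
  open import Data.Rational.Properties
  open import Data.Sum.Base using (inj₁; inj₂)
  open import Relation.Binary.PropositionalEquality

  private
    variable
      a b c d : ℕ

  infix 8 _//_

  -- Otherwise the type checker unfolds the normalisation of fractions.
  abstract

    _//_ : ℕ → (b : ℕ) .{{_ : NonZero b}} → ℚ
    a // b = + a / b

    //-< : .{{_ : NonZero b}} .{{_ : NonZero d}} → a ℕ.* d ℕ.< c ℕ.* b → a // b < c // d
    //-< {b = suc b} {d = suc d} {a = a} {c = c} ad<cb = toℚᵘ-cancel-<
      (ℚᵘ.<-respˡ-≃ (ℚᵘ.≃-sym (toℚᵘ-fromℚᵘ (mkℚᵘ (+ a) b)))
        (ℚᵘ.<-respʳ-≃ (ℚᵘ.≃-sym (toℚᵘ-fromℚᵘ (mkℚᵘ (+ c) d)))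
          (*<* (subst₂ ℤ._<_ (ℤ.pos-* a (suc d)) (ℤ.pos-* c (suc b)) (ℤ.+<+ ad<cb)))))

    //-≡ : .{{_ : NonZero b}} .{{_ : NonZero d}} → a ℕ.* d ≡ c ℕ.* b → a // b ≡ c // d
    //-≡ {b = suc b} {d = suc d} {a = a} {c = c} ad≡cb = fromℚᵘ-cong {mkℚᵘ (+ a) b} {mkℚᵘ (+ c) d}
      (*≡* (trans (sym (ℤ.pos-* a (suc d))) (trans (cong +_ ad≡cb) (ℤ.pos-* c (suc b)))))

    //-≤ : .{{_ : NonZero b}} .{{_ : NonZero d}} → a ℕ.* d ℕ.≤ c ℕ.* b → a // b ≤ c // d
    //-≤ {b} {d} {a} {c} ad≤cb with ℕ.m≤n⇒m<n∨m≡n ad≤cb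
    ... | inj₁ ad<cb = <⇒≤ (//-< {b} {d} {a} {c} ad<cb)
    ... | inj₂ ad≡cb = ≤-reflexive (//-≡ {b} {d} {a} {c} ad≡cb)

    //-* : ∀ a b c d .{{_ : NonZero b}} .{{_ : NonZero d}} →
           a // b * c // d ≡ _//_ (a ℕ.* c) (b ℕ.* d) {{ℕ.m*n≢0 b d}}
    //-* a (suc b) c (suc d) = toℚᵘ-injective (begin
      toℚᵘ (a // suc b * c // suc d)               ≈⟨ toℚᵘ-homo-* (a // suc b) (c // suc d) ⟩
      toℚᵘ (a // suc b) ℚᵘ.* toℚᵘ (c // suc d)     ≈⟨ ℚᵘ.*-cong (toℚᵘ-fromℚᵘ (mkℚᵘ (+ a) b)) (toℚᵘ-fromℚᵘ (mkℚᵘ (+ c) d)) ⟩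
      mkℚᵘ (+ a) b ℚᵘ.* mkℚᵘ (+ c) d               ≡⟨ cong (λ n → mkℚᵘ n (ℕ.pred (suc b ℕ.* suc d))) (sym (ℤ.pos-* a c)) ⟩
      mkℚᵘ (+ (a ℕ.* c)) (ℕ.pred (suc b ℕ.* suc d)) ≈⟨ toℚᵘ-fromℚᵘ (mkℚᵘ (+ (a ℕ.* c)) (ℕ.pred (suc b ℕ.* suc d))) ⟨
      toℚᵘ ((a ℕ.* c) // (suc b ℕ.* suc d))          ∎)
      where open ℚᵘ.≃-Reasoning

    //-+ : ∀ a c b .{{_ : NonZero b}} → a // b + c // b ≡ (a ℕ.+ c) // b
    //-+ a c (suc b) = toℚᵘ-injective (begin
      toℚᵘ (a // suc b + c // suc b)               ≈⟨ toℚᵘ-homo-+ (a // suc b) (c // suc b) ⟩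
      toℚᵘ (a // suc b) ℚᵘ.+ toℚᵘ (c // suc b)     ≈⟨ ℚᵘ.+-cong (toℚᵘ-fromℚᵘ (mkℚᵘ (+ a) b)) (toℚᵘ-fromℚᵘ (mkℚᵘ (+ c) b)) ⟩
      mkℚᵘ (+ a) b ℚᵘ.+ mkℚᵘ (+ c) b               ≈⟨ *≡* (trans (common (+ a) (+ c) (+ suc b)) (cong ((+ a ℤ.+ + c) ℤ.*_) (sym (ℤ.pos-* (suc b) (suc b))))) ⟩
      mkℚᵘ (+ (a ℕ.+ c)) b                         ≈⟨ toℚᵘ-fromℚᵘ (mkℚᵘ (+ (a ℕ.+ c)) b) ⟨
      toℚᵘ ((a ℕ.+ c) // suc b)                    ∎)
      where
      open ℚᵘ.≃-Reasoning
      common : ∀ a c b → (a ℤ.* b ℤ.+ c ℤ.* b) ℤ.* b ≡ (a ℤ.+ c) ℤ.* (b ℤ.* b)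
      common = solve-∀

    0<// : ∀ {a b} .{{_ : NonZero b}} → 0 ℕ.< a → 0ℚ < a // b
    0<// {suc a} {b} _ = positive⁻¹ (suc a // b) {{normalize-pos (suc a) b}}

    //1 : ∀ n → n // 1 ≡ + n / 1
    //1 n = refl

-- Estimates for Dedekind cuts.

module Cuts where

  open Reals using (box; lower<upper)
  open Reals.ℝ
  open import Data.Rational.Base using (ℚ; 0ℚ; 1ℚ; _+_; _*_; -_; _<_; _≤_; _⊓_; _⊔_; positive; nonNegative)
  open import Data.Rational.Properties
  open import Data.Rational.Solver using (module +-*-Solver)
  open +-*-Solver using (solve; _:+_; _:=_; :-_)
  open import Data.Product.Base using (_,_; proj₂)
  open import Data.Sum.Base using (inj₁; inj₂)
  open import Relation.Binary.PropositionalEquality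

  private
    variable
      x y : ℝ
      a b c d q s t : ℚ

  *-mono-≤-nonNeg : 0ℚ ≤ a → 0ℚ ≤ d → a ≤ b → c ≤ d → a * c ≤ b * d
  *-mono-≤-nonNeg {a} {d} 0≤a 0≤d a≤b c≤d =
    ≤-trans (*-monoˡ-≤-nonNeg a {{nonNegative 0≤a}} c≤d) (*-monoʳ-≤-nonNeg d {{nonNegative 0≤d}} a≤b)

  *-mono-<-pos : 0ℚ < a → 0ℚ < d → a < b → c < d → a * c < b * d
  *-mono-<-pos {a} {d} 0<a 0<d a<b c<d =
    <-trans (*-monoʳ-<-pos a {{positive 0<a}} c<d) (*-monoˡ-<-pos d {{positive 0<d}} a<b)

  0<* : 0ℚ < a → 0ℚ < b → 0ℚ < a * b
  0<* {a} {b} 0<a 0<b = subst (_< a * b) (*-zeroʳ a) (*-monoʳ-<-pos a {{positive 0<a}} 0<b)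

  -- Says that the real number is the rational one, through the inclusions of its cuts into those of
  -- a. These are the directions in which a given element of a cut of J - K N / p is exploited.
  record _≐_ (x : ℝ) (a : ℚ) : Set where
    field
      lower : ∀ {q} → Lower x q → q < a
      upper : ∀ {q} → Upper x q → a < q

  open _≐_

  fromℚ-≐ : ∀ a → fromℚ a ≐ a
  fromℚ-≐ a = record { lower = λ q<a → q<a ; upper = λ a<q → a<q }

  -- The upper end of a box dominates the corner b d ≥ s t. At the lower end c may be negative: if c
  -- ≥ 0 the corner a c is at most s t, and otherwise b c ≤ 0 < s t.
  *-≐ : 0ℚ < s → 0ℚ < t → x ≐ s → y ≐ t → (x *ᵣ y) ≐ (s * t)
  *-≐ {s} {t} 0<s 0<t x≐s y≐t = record
    { lower = λ { (box {a} {b} {c} {d} a<x x<b c<y y<d , q<lo) →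
        <-≤-trans q<lo (low {a} {b} {c} {d} (<⇒≤ (lower x≐s a<x)) (<⇒≤ (<-trans 0<s (upper x≐s x<b))) (<⇒≤ (lower y≐t c<y))) }
    ; upper = λ { (box {a} {b} {c} {d} a<x x<b c<y y<d , hi<q) →
        ≤-<-trans (≤-trans (high (<⇒≤ (upper x≐s x<b)) (<⇒≤ (upper y≐t y<d)))
          (≤-trans (p≤q⊔p (b * c) (b * d)) (p≤q⊔p ((a * c) ⊔ (a * d)) ((b * c) ⊔ (b * d))))) hi<q } }
    where
    0≤s = <⇒≤ 0<s
    0≤t = <⇒≤ 0<t
    high : ∀ {b d} → s ≤ b → t ≤ d → s * t ≤ b * d
    high s≤b t≤d = *-mono-≤-nonNeg 0≤s (≤-trans 0≤t t≤d) s≤b t≤d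
    low : ∀ {a b c d} → a ≤ s → 0ℚ ≤ b → c ≤ t → ((a * c) ⊓ (a * d)) ⊓ ((b * c) ⊓ (b * d)) ≤ s * t
    low {a} {b} {c} {d} a≤s 0≤b c≤t with ≤-total 0ℚ c
    ... | inj₁ 0≤c = ≤-trans (≤-trans (p⊓q≤p ((a * c) ⊓ (a * d)) _) (p⊓q≤p (a * c) (a * d)))
      (≤-trans (*-monoʳ-≤-nonNeg c {{nonNegative 0≤c}} a≤s) (*-monoˡ-≤-nonNeg s {{nonNegative 0≤s}} c≤t))
    ... | inj₂ c≤0 = ≤-trans (≤-trans (p⊓q≤q ((a * c) ⊓ (a * d)) _) (p⊓q≤p (b * c) (b * d)))
      (≤-trans (subst (b * c ≤_) (*-zeroʳ b) (*-monoˡ-≤-nonNeg b {{nonNegative 0≤b}} c≤0)) (<⇒≤ (0<* 0<s 0<t)))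

  1/-≐ : {{_ : Positive x}} → 0ℚ < s → 0ℚ < t → s * t ≡ 1ℚ → x ≐ s → (1/ᵣ x) ≐ t
  1/-≐ {s = s} {t} 0<s 0<t st≡1 x≐s = record
    { lower = λ { (b , r , x<b , br≤1 , q<r) → ≰⇒> λ t≤q → <-irrefl refl (<-≤-trans
        (subst (_< b * r) st≡1 (*-mono-<-pos 0<s (<-trans 0<t (≤-<-trans t≤q q<r)) (upper x≐s x<b) (≤-<-trans t≤q q<r))) br≤1) }
    ; upper = λ { (a , r , 0<a , a<x , 1≤ar , r<q) → ≰⇒> λ q≤t → <-irrefl refl (≤-<-trans 1≤ar
        (subst (a * r <_) st≡1 (*-mono-<-pos 0<a 0<t (lower x≐s a<x) (<-≤-trans r<q q≤t)))) } }

  private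
    shift-bound : ∀ {n a e b} → n ≤ a + e → a < - b → n + b < e
    shift-bound {n} {a} {e} {b} n≤a+e a<-b = ≤-<-trans (+-monoˡ-≤ b n≤a+e)
      (subst (a + e + b <_) (cancel e b) (+-monoˡ-< b (+-monoˡ-< e a<-b)))
      where
      cancel : ∀ e b → - b + e + b ≡ e
      cancel = solve 2 (λ e b → :- b :+ e :+ b := e) refl

  -- The two injections are the two signs in the maximum of x - y and y - x, and each is settled by
  -- one of the two inequalities between n and a.
  ∣-∣-lower : ∀ {n e} → x ≐ n → y ≐ a → n ≤ a + e → a ≤ n + e → ∀ {q} → Lower (∣ x -ᵣ y ∣ᵣ) q → q < e
  ∣-∣-lower x≐n y≐a n≤ a≤ (inj₁ (u , v , u<x , v<-y , q<u+v)) =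
    <-trans q<u+v (<-trans (+-monoˡ-< v (lower x≐n u<x)) (shift-bound n≤ (upper y≐a v<-y)))
  ∣-∣-lower {a = a} {n} {e} x≐n y≐a n≤ a≤ {q} (inj₂ (u , v , x<u , -y<v , u+v<-q)) =
    subst (_< e) (cancel n q) (<-≤-trans (+-monoʳ-< (- n) n+q<a) bound)
    where
    cancel : ∀ n q → - n + (n + q) ≡ q
    cancel = solve 2 (λ n q → :- n :+ (n :+ q) := q) refl
    -v<a : - v < a
    -v<a = lower y≐a -y<v
    n+v<-q : n + v < - q
    n+v<-q = <-trans (+-monoˡ-< v (upper x≐n x<u)) u+v<-q
    move : ∀ n v q → n + v + (q + - v) ≡ n + q
    move = solve 3 (λ n v q → n :+ v :+ (q :+ :- v) := n :+ q) refl
    move′ : ∀ v q → - q + (q + - v) ≡ - v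
    move′ = solve 2 (λ v q → :- q :+ (q :+ :- v) := :- v) refl
    n+q<a : n + q < a
    n+q<a = <-trans (subst₂ _<_ (move n v q) (move′ v q) (+-monoˡ-< (q + - v) n+v<-q)) -v<a
    bound : - n + a ≤ e
    bound = subst (- n + a ≤_) (cancel n e) (+-monoʳ-≤ (- n) a≤)

  -- Openness supplies strictly larger a′ and b′ in the lower cuts. In a box with these lower ends
  -- all corners are at least a′ b′, which exceeds a b strictly.
  *-lower : 0ℚ < a → 0ℚ < b → Lower x a → Lower y b → Lower (x *ᵣ y) (a * b)
  *-lower {a} {b} {x} {y} 0<a 0<b a<x b<y with lower-open x a<x | lower-open y b<y
  ... | a′ , a<a′ , a′<x | b′ , b<b′ , b′<y = box a′<x x<c b′<y y<d ,
    <-≤-trans (*-mono-<-pos 0<a 0<b′ a<a′ b<b′)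
      (⊓-glb (⊓-glb ≤-refl (corner ≤-refl b′≤d)) (⊓-glb (corner a′≤c ≤-refl) (corner a′≤c b′≤d)))
    where
    0<a′ = <-trans 0<a a<a′
    0<b′ = <-trans 0<b b<b′
    x<c = proj₂ (upper-inhabited x)
    y<d = proj₂ (upper-inhabited y)
    a′≤c = <⇒≤ (lower<upper x a′<x x<c)
    b′≤d = <⇒≤ (lower<upper y b′<y y<d)
    corner : ∀ {c d} → a′ ≤ c → b′ ≤ d → a′ * b′ ≤ c * d
    corner a′≤c b′≤d = *-mono-≤-nonNeg (<⇒≤ 0<a′) (≤-trans (<⇒≤ 0<b′) b′≤d) a′≤c b′≤d

  +-lowerˡ : 0ℚ < b → Lower x a → Lower y b → Lower (x +ᵣ y) a
  +-lowerˡ {b} {a = a} 0<b a<x b<y = a , b , a<x , b<y , subst (_< a + b) (+-identityʳ a) (+-monoʳ-< a 0<b)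

  +-lowerʳ : 0ℚ < a → Lower x a → Lower y b → Lower (x +ᵣ y) b
  +-lowerʳ {a} {b = b} 0<a a<x b<y = a , b , a<x , b<y , subst (_< a + b) (+-identityˡ b) (+-monoˡ-< b 0<a)

  1/-lower : {{_ : Positive x}} → Upper x b → b * c ≤ 1ℚ → q < c → Lower (1/ᵣ x) q
  1/-lower x<b bc≤1 q<c = _ , _ , x<b , bc≤1 , q<c

  √-lower : 0ℚ ≤ a → Lower x (a * a) → q < a → Lower (√ x) q
  √-lower 0≤a a²<x q<a = inj₂ (_ , q<a , 0≤a , a²<x)

  √-upper : 0ℚ < a → Upper x (a * a) → a < q → Upper (√ x) q
  √-upper 0<a x<a² a<q = _ , a<q , 0<a , x<a²

-- Rational approximations to the roots and quotients of the theorem.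

module FractionalCuts where

  open Scales
  open Fractions
  open Cuts
  open Reals.ℝ using (Lower; Upper)
  open import Data.Nat.Base
  open import Data.Nat.Properties
  open import Data.Nat.Tactic.RingSolver using (solve-∀)
  open import Data.Integer.Base using (+_)
  open import Data.Rational.Base using (1ℚ) renaming (_*_ to _*ᵠ_; _<_ to _<ᵠ_; _≤_ to _≤ᵠ_; _+_ to _+ᵠ_)
  import Data.Rational.Properties as ℚ
  open import Relation.Binary.PropositionalEquality hiding (J)

  fromℕ-≐ : ∀ n → fromℕ n ≐ (n // 1)
  fromℕ-≐ n = subst (fromℕ n ≐_) (sym (//1 n)) (fromℚ-≐ _)

  *-lower-// : ∀ {x y} a b c d .{{_ : NonZero b}} .{{_ : NonZero d}} .{{_ : NonZero (b * d)}} → 1 ≤ a → 1 ≤ c →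
               Lower x (a // b) → Lower y (c // d) → Lower (x *ᵣ y) ((a * c) // (b * d))
  *-lower-// {x} {y} a b c d 1≤a 1≤c x-lower y-lower = subst (Lower (x *ᵣ y)) (//-* a b c d)
    (*-lower {a // b} {c // d} {x} {y} (0<// {a} {b} 1≤a) (0<// {c} {d} 1≤c) x-lower y-lower)

  *-≐-// : ∀ {x y} a b c d .{{_ : NonZero b}} .{{_ : NonZero d}} .{{_ : NonZero (b * d)}} → 1 ≤ a → 1 ≤ c →
           x ≐ (a // b) → y ≐ (c // d) → (x *ᵣ y) ≐ ((a * c) // (b * d))
  *-≐-// {x} {y} a b c d 1≤a 1≤c x≐ y≐ = subst ((x *ᵣ y) ≐_) (//-* a b c d)
    (*-≐ {a // b} {c // d} {x} {y} (0<// {a} {b} 1≤a) (0<// {c} {d} 1≤c) x≐ y≐)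

  1/-≐-// : ∀ {x} {{_ : Positive x}} n .{{_ : NonZero n}} → x ≐ (n // 1) → (1/ᵣ x) ≐ (1 // n)
  1/-≐-// {x} n@(suc _) x≐n = 1/-≐ {x} {n // 1} {1 // n} (0<// {n} {1} (s≤s z≤n)) (0<// {1} {n} (s≤s z≤n)) unit x≐n
    where
    ones : ∀ n → n * 1 * 1 ≡ 1 * (1 * n)
    ones = solve-∀
    unit : n // 1 *ᵠ 1 // n ≡ 1ℚ
    unit = trans (//-* n 1 1 n) (trans (//-≡ {1 * n} {1} {n * 1} {1} (ones n)) (//1 1))

  /-lower-// : ∀ {x y} {{y>0 : Positive y}} a b c d .{{_ : NonZero b}} .{{_ : NonZero d}} .{{_ : NonZero (b * d)}} → 1 ≤ a → 1 ≤ c →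
               Lower x (a // b) → Lower (1/ᵣ y) (c // d) → Lower (x /ᵣ y) ((a * c) // (b * d))
  /-lower-// {x} {y} = *-lower-// {x} {1/ᵣ y}

  /-≐-// : ∀ {x y} {{y>0 : Positive y}} a b n .{{_ : NonZero b}} .{{_ : NonZero n}} .{{_ : NonZero (b * n)}} → 1 ≤ a →
           x ≐ (a // b) → y ≐ (n // 1) → (x /ᵣ y) ≐ ((a * 1) // (b * n))
  /-≐-// {x} {y} a b n 1≤a x≐ y≐ = *-≐-// {x} {1/ᵣ y} a b 1 n 1≤a ≤-refl x≐ (1/-≐-// {y} n y≐)

  ∣-∣-lower-// : ∀ {x y} m a e n .{{_ : NonZero n}} → x ≐ (m // 1) → y ≐ (a // n) → n * m ≤ a + e → a ≤ n * m + e →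
                 ∀ {q} → Lower (∣ x -ᵣ y ∣ᵣ) q → q <ᵠ e // n
  ∣-∣-lower-// {x} {y} m a e n@(suc _) x≐ y≐ nm≤a+e a≤nm+e = ∣-∣-lower {x} {y} {a // n} {m // 1} {e // n} x≐ y≐
    (subst (m // 1 ≤ᵠ_) (sym (//-+ a e n))
      (//-≤ {1} {n} {m} {a + e} (subst₂ _≤_ (*-comm n m) (sym (*-identityʳ (a + e))) nm≤a+e)))
    (subst (a // n ≤ᵠ_) (trans (sym (//-+ (n * m) e n)) (cong (_+ᵠ e // n)
        (//-≡ {n} {1} {n * m} {m} (trans (*-identityʳ (n * m)) (*-comm n m)))))
      (//-≤ {n} {n} {a} {n * m + e} (*-monoˡ-≤ n a≤nm+e)))

  -- Both conditions in the cut of a root are strict, so an intermediate fraction is needed: 2 m / 3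
  -- lies above m / 2, and its square 4 m² / 9 lies below n.
  √-lower-half : ∀ {m n} → 1 ≤ m → sq m ≤ n → Lower (√ fromℕ n) (m // 2)
  √-lower-half {m} {n} 1≤m m²≤n = √-lower {a = (2 * m) // 3} {x = fromℕ n} (ℚ.<⇒≤ (0<// {2 * m} {3} (*-mono-≤ {1} {2} (s≤s z≤n) 1≤m)))
    (subst₂ _<ᵠ_ (sym (//-* (2 * m) 3 (2 * m) 3)) (//1 n) (//-< {9} {1} {2 * m * (2 * m)} {n} square<))
    (//-< {2} {3} {m} {2 * m} (subst (m * 3 <_) (double m) (*-monoʳ-< m {{>-nonZero 1≤m}} (n<1+n 3))))
    where
    double : ∀ m → m * 4 ≡ 2 * m * 2
    double = solve-∀
    quadruple : ∀ m → 2 * m * (2 * m) * 1 ≡ m * m * 4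
    quadruple = solve-∀
    square< : 2 * m * (2 * m) * 1 < n * 9
    square< = begin-strict
      2 * m * (2 * m) * 1  ≡⟨ quadruple m ⟩
      m * m * 4            ≤⟨ *-monoˡ-≤ 4 m²≤n ⟩
      n * 4                <⟨ *-monoʳ-< n {{>-nonZero (≤-trans (*-mono-≤ 1≤m 1≤m) m²≤n)}} (s≤s (m≤m+n 4 4)) ⟩
      n * 9                ∎
      where open ≤-Reasoning

  -- As w ≤ 2 p^(3/2), the fraction w / (2 p) is at most √p. The intermediate value w / (3 p) has
  -- square at most 4 p / 9 < p and leaves room above w / (4 p).
  √-lower-quarter : ∀ p w .{{_ : NonZero p}} → 1 ≤ w → sq w ≤ 4 * (p * p * p) → Lower (√ fromℕ p) (_//_ w (4 * p) {{m*n≢0 4 p}})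
  √-lower-quarter p@(suc _) w 1≤w w²≤4p³ = √-lower {a = w // (3 * p)} {x = fromℕ p} (ℚ.<⇒≤ (0<// {w} {3 * p} 1≤w))
    (subst₂ _<ᵠ_ (sym (//-* w (3 * p) w (3 * p))) (//1 p) (//-< {3 * p * (3 * p)} {1} {w * w} {p} square<))
    (//-< {4 * p} {3 * p} {w} {w} (*-monoʳ-< w {{>-nonZero 1≤w}} (*-monoˡ-< p (n<1+n 3))))
    where
    nine : ∀ p → p * p * p * 9 ≡ p * (3 * p * (3 * p))
    nine = solve-∀
    square< : w * w * 1 < p * (3 * p * (3 * p))
    square< = begin-strict
      w * w * 1            ≡⟨ *-identityʳ (w * w) ⟩
      w * w                ≤⟨ w²≤4p³ ⟩
      4 * (p * p * p)      ≡⟨ *-comm 4 (p * p * p) ⟩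
      p * p * p * 4        <⟨ *-monoʳ-< (p * p * p) (s≤s (m≤m+n 4 4)) ⟩
      p * p * p * 9        ≡⟨ nine p ⟩
      p * (3 * p * (3 * p)) ∎
      where open ≤-Reasoning

  √-upper-nat : ∀ {x} a b → 1 ≤ a → Upper x ((a * a) // 1) → a < b → Upper (√ x) (b // 1)
  √-upper-nat {x} a b 1≤a x<a² a<b = √-upper {a = a // 1} {x = x} (0<// {a} {1} 1≤a)
    (subst (Upper x) (sym (//-* a 1 a 1)) x<a²) (//-< {1} {1} {a} {b} (*-monoˡ-< 1 a<b))

  -- Taking roots twice gives p < b², √p < d² and √√p < 2 d, with 2 d in place of d for strictness;
  -- passing to the reciprocal strictly costs the step from 2 to 3.
  1/√√-lower : ∀ {p b d} (√√p>0 : Positive (√ √ fromℕ p)) .{{_ : NonZero d}} .{{_ : NonZero (3 * d)}} →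
               1 ≤ b → p < sq b → b < sq d → Lower (1/ᵣ_ (√ √ fromℕ p) {{√√p>0}}) (1 // (3 * d))
  1/√√-lower {p} {b} {d@(suc _)} √√p>0 1≤b p<b² b<d² =
    1/-lower {x = √ √ fromℕ p} {b = (2 * d) // 1} {c = 1 // (2 * d)} {{√√p>0}}
      (√-upper-nat {√ fromℕ p} d (2 * d) (s≤s z≤n)
        (√-upper-nat {fromℕ p} b (d * d) 1≤b (subst (_<ᵠ (b * b) // 1) (//1 p) (//-< {1} {1} {p} {b * b} (*-monoˡ-< 1 p<b²))) b<d²)
        (m<m+n d (s≤s z≤n)))
      (ℚ.≤-reflexive (trans (//-* (2 * d) 1 1 (2 * d)) (trans (//-≡ {1 * (2 * d)} {1} {2 * d * 1} {1} (one d)) (//1 1))))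
      (//-< {3 * d} {2 * d} {1} {1} (*-monoʳ-< 1 (*-monoˡ-< d (n<1+n 2))))
    where
    one : ∀ d → 2 * d * 1 * 1 ≡ 1 * (1 * (2 * d))
    one = solve-∀

-- Both sides of the theorem compared with 20 t w / p.

module RealBounds where

  open Scales
  open Fractions
  open Cuts
  open FractionalCuts
  open Reals.ℝ using (Lower; lower-closed)
  open import Data.Nat.Base
  open import Data.Nat.Properties
  open import Data.Nat.Tactic.RingSolver using (solve-∀)
  open import Data.Integer.Base using (+_)
  open import Data.Rational.Base using () renaming (_<_ to _<ᵠ_)
  import Data.Rational.Properties as ℚ
  open import Data.Sum.Base using ([_,_]′)
  open import Relation.Binary.PropositionalEquality hiding (J)

  module _ {c p K N : ℕ} .{{p≢0 : NonZero p}} (3840≤c : 3840 ≤ c) (1≤p : 1 ≤ p) (S : Scale p K N) (R : Roots p K N)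
           (√√p>0 : Positive (√ √ fromℕ p)) where

    open Scale S
    open Roots R

    private
      instance
        d≢0 : NonZero d
        d≢0 = >-nonZero 1≤d
        3d≢0 : NonZero (3 * d)
        3d≢0 = m*n≢0 3 d
        12d≢0 : NonZero (2 * 2 * (3 * d))
        12d≢0 = m*n≢0 4 (3 * d)
        12d≢0′ : NonZero (1 * (2 * 2 * (3 * d)))
        12d≢0′ = m*n≢0 1 (2 * 2 * (3 * d))
        4p≢0 : NonZero (4 * p)
        4p≢0 = m*n≢0 4 p
        4p≢0′ : NonZero (1 * (4 * p))
        4p≢0′ = m*n≢0 1 (4 * p)

      X Y C : ℝ
      X = _/ᵣ_ (√ fromℤ (+ K) *ᵣ √ fromℤ (+ N)) (√ √ fromℕ p) {{√√p>0}}
      Y = √ fromℕ p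
      C = fromℚ (suc c // 1)

      1≤w : 1 ≤ w
      1≤w = sq-cancel (≤-trans (*-mono-≤ (*-mono-≤ 1≤p 1≤p) 1≤p) p³≤w²)
      1≤κν : 1 ≤ κ * ν
      1≤κν = *-mono-≤ 1≤κ 1≤ν
      1≤κν1 : 1 ≤ κ * ν * 1
      1≤κν1 = *-mono-≤ 1≤κν (≤-refl {1})

      X-lower : Lower X ((κ * ν * 1) // (2 * 2 * (3 * d)))
      X-lower = /-lower-// {√ fromℤ (+ K) *ᵣ √ fromℤ (+ N)} {√ √ fromℕ p} {{√√p>0}} (κ * ν) (2 * 2) 1 (3 * d) 1≤κν ≤-refl
        (*-lower-// {√ fromℤ (+ K)} {√ fromℤ (+ N)} κ 2 ν 2 1≤κ 1≤ν (√-lower-half {κ} {K} 1≤κ κ²≤K) (√-lower-half {ν} {N} 1≤ν ν²≤N))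
        (1/√√-lower {p} {b} {d} √√p>0 1≤b p<b² b<d²)

      Y-lower : Lower Y (w // (4 * p))
      Y-lower = √-lower-quarter p w 1≤w w²≤4p³

      scaled : ∀ {q} m n .{{_ : NonZero n}} .{{_ : NonZero (1 * n)}} → 1 ≤ m → Lower (X +ᵣ Y) (m // n) →
               20 * (t * w) * (1 * n) ≤ c * m * p → q <ᵠ (20 * (t * w)) // p → Lower (C *ᵣ (X +ᵣ Y)) q
      scaled m n 1≤m m/n-lower e≤ q< = lower-closed (C *ᵣ (X +ᵣ Y))
        (ℚ.<-≤-trans q< (//-≤ {p} {1 * n} {20 * (t * w)} {c * m} e≤))
        -- The constant is `suc c` so that c lies strictly below it and belongs to its lower cut.
        (*-lower-// {C} {X +ᵣ Y} c 1 m n (≤-trans (s≤s z≤n) 3840≤c) 1≤m (//-< {1} {1} {c} {suc c} (*-monoˡ-< 1 (n<1+n c))) m/n-lower)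

    -- One summand suffices in each case of `t-small`: √p for t = 1, and the quotient with p^(1/4)
    -- when t² w ≤ K N. The other summand is positive and is dropped.
    bound-lower : ∀ {q} → q <ᵠ (20 * (t * w)) // p →
                  Lower (C *ᵣ (X +ᵣ Y)) q
    bound-lower = [ (λ t≡1 → scaled w (4 * p) 1≤w
                      (+-lowerʳ {(κ * ν * 1) // (2 * 2 * (3 * d))} {X} {Y} {w // (4 * p)} (0<// {κ * ν * 1} {2 * 2 * (3 * d)} 1≤κν1) X-lower Y-lower)
                      (small-scale 3840≤c S t≡1))
                  , (λ t²w≤KN → scaled (κ * ν * 1) (2 * 2 * (3 * d)) 1≤κν1
                      (+-lowerˡ {w // (4 * p)} {X} {(κ * ν * 1) // (2 * 2 * (3 * d))} {Y} (0<// {w} {4 * p} 1≤w) X-lower Y-lower)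
                      (large-scale 3840≤c S R t²w≤KN))
                  ]′ t-small

  ∣-∣ᵣ-bound : ∀ {J K N p e} .{{p≢0 : NonZero p}} (p>0 : Positive (fromℕ p)) → 1 ≤ K → 1 ≤ N →
               p * J ≤ K * N + e → K * N ≤ p * J + e →
               ∀ {q} → Lower (∣ fromℕ J -ᵣ _/ᵣ_ (fromℤ (+ K) *ᵣ fromℤ (+ N)) (fromℕ p) {{p>0}} ∣ᵣ) q → q <ᵠ e // p
  ∣-∣ᵣ-bound {J} {K} {N} {p} {e} {{p≢0}} p>0 1≤K 1≤N pJ≤ KN≤ =
    ∣-∣-lower-// {fromℕ J} {_/ᵣ_ (fromℤ (+ K) *ᵣ fromℤ (+ N)) (fromℕ p) {{p>0}}} J (K * N) e p (fromℕ-≐ J)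
      (subst (_≐_ (_/ᵣ_ (fromℤ (+ K) *ᵣ fromℤ (+ N)) (fromℕ p) {{p>0}})) (//-≡ {1 * 1 * p} {p} {K * N * 1} {K * N} (arrange K N p))
        (/-≐-// {fromℤ (+ K) *ᵣ fromℤ (+ N)} {fromℕ p} {{p>0}} (K * N) (1 * 1) p (*-mono-≤ 1≤K 1≤N)
          (*-≐-// {fromℤ (+ K)} {fromℤ (+ N)} K 1 N 1 1≤K 1≤N (fromℕ-≐ K) (fromℕ-≐ N)) (fromℕ-≐ p)))
      pJ≤ KN≤
    where
    instance
      p≢0′ : NonZero (1 * 1 * p)
      p≢0′ = m*n≢0 (1 * 1) p
    arrange : ∀ K N p → K * N * 1 * p ≡ K * N * (1 * 1 * p)
    arrange = solve-∀

-- The theorem over the real numbers.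

open Scales
open Fractions
open Deviation
open RealBounds
open import Data.Nat.Base as ℕ using (ℕ; suc; z≤n; s≤s; NonZero)
import Data.Nat.Properties as ℕ
open import Data.Nat.Primality using (Prime; prime⇒nonZero)
open import Data.Integer.Base using (ℤ; +_; 1ℤ; _≤_; _<_; +≤+; +<+)
import Data.Rational.Properties as ℚ
open Reals using (box)
open import Function.Base using (case_of_)
open import Data.Sum.Base using (inj₁; inj₂)
open import Data.Product.Base using (Σ-syntax; _×_; _,_; proj₁; proj₂)

module _ (p : ℕ) (p-prime : Prime p) (p>0 : Positive (fromℕ p)) (√√p>0 : Positive (√ √ fromℕ p)) where

  -- Since `≤ᵣ` is inclusion of lower cuts, a rational q below the left side is shown to be below 20
  -- t w / p and thence below the right side. The lower bound on `c` and the positivity proofs enter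
  -- as variables.
  deviation-bound : ∀ {c g} (root : PrimitiveRoot p g) (N K : ℕ) (M H : ℤ) → 3840 ℕ.≤ c →
    1 ℕ.≤ N → N ℕ.< p → 1 ℕ.≤ K → K ℕ.< p →
    ∣ fromℕ (powersInInterval p g root H (+ K) M (+ N)) -ᵣ _/ᵣ_ (fromℤ (+ K) *ᵣ fromℤ (+ N)) (fromℕ p) {{p>0}} ∣ᵣ
    ≤ᵣ fromℚ (suc c // 1) *ᵣ (_/ᵣ_ (√ fromℤ (+ K) *ᵣ √ fromℤ (+ N)) (√ √ fromℕ p) {{√√p>0}} +ᵣ √ fromℕ p)
  deviation-bound {c} {g} root N K M H 3840≤c 1≤N N<p 1≤K K<p q q<lhs =
    bound-lower {c} {p} {K} {N} 3840≤c 1≤p S (roots 1≤p 1≤K 1≤N) √√p>0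
      (∣-∣ᵣ-bound {powersInInterval p g root H (+ K) M (+ N)} {K} {N} {p} {20 ℕ.* (Scale.t S ℕ.* Scale.w S)} p>0 1≤K 1≤N
        (proj₁ deviation) (proj₂ deviation) q<lhs)
    where
    instance
      p≢0 : NonZero p
      p≢0 = prime⇒nonZero p-prime
    1≤p = ℕ.≤-trans 1≤K (ℕ.<⇒≤ K<p)
    S = scale 1≤K K<p 1≤N N<p
    deviation = powersInInterval-deviation p-prime root H K M N S K<p N<p

positive : ∀ p → Prime p → Positive (fromℕ p)
positive p p-prime = fromℕ-positive {p} {{prime⇒nonZero p-prime}}

√√-positive : ∀ p → Prime p → Positive (√ √ fromℕ p)
√√-positive p p-prime = √-positive {√ fromℕ p} {{√-positive {fromℕ p} {{positive p p-prime}}}}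

theorem1 :
    Σ[ C ∈ ℝ ] 0ᵣ <ᵣ C ×
      ((p : ℕ) (p-prime : Prime p) (g : ℤ) (root : PrimitiveRoot p g) (N K M H : ℤ) →
       1ℤ ≤ N → N < + p → 1ℤ ≤ K → K < + p →
       let instance p≢0 = prime⇒nonZero p-prime
           J = powersInInterval p g root H K M N
       in ∣ fromℕ J -ᵣ fromℤ K *ᵣ fromℤ N /ᵣ fromℕ p ∣ᵣ
            ≤ᵣ C *ᵣ (√ fromℤ K *ᵣ √ fromℤ N /ᵣ √ √ fromℕ p +ᵣ √ fromℕ p))
-- The cuts are taken apart and rebuilt so that the instances of Positive, which
-- elaborate to very large terms, are never compared.
theorem1 = fromℚ (3841 // 1) , ℚ.<-dense (0<// {3841} {1} (s≤s z≤n)) ,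
  λ { p p-prime g root (+ N) (+ K) M H (+≤+ 1≤N) (+<+ N<p) (+≤+ 1≤K) (+<+ K<p) q q<lhs →
        case deviation-bound p p-prime (positive p p-prime) (√√-positive p p-prime) {3840} root N K M H ℕ.≤-refl 1≤N N<p 1≤K K<p q
          (case q<lhs of λ
            { (inj₁ (a , b , la , (box s t u v , h) , lt)) → inj₁ (a , b , la , (box s t u v , h) , lt)
            ; (inj₂ (a , b , ua , (box s t u v , h) , lt)) → inj₂ (a , b , ua , (box s t u v , h) , lt)
            }) of λ
          { (box C< <C (e , f , (box s t u v , h) , Y< , lt) (e′ , f′ , (box s′ t′ u′ v′ , h′) , <Y , lt′) , q<) →
            (box C< <C (e , f , (box s t u v , h) , Y< , lt) (e′ , f′ , (box s′ t′ u′ v′ , h′) , <Y , lt′) , q<) } }
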